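{- For every $k\in\mathbb{N}$ and all positive integers $\ell_1,\ldots,\ell_k$, there exists $n_0$ such that the following holds: if $n\geq n_0$ and $\sigma$ is the layered permutation with layers of sizes $(n,1,\ell_1,\dots,\ell_k)$, then for every near-$\sigma$-optimal sequence $(\pi_m)_{m\in\mathbb{N}}$ of layered permutations, the number of layers of $\pi_m$ tends to infinity as $m\to\infty$.
   Context: A permutation of order $n$ is a bijection $\pi:[n]\to[n]$. For $m$ points $i_1<\cdots<i_m$ of $[n]$, the permutation they induce is the unique $\tau:[m]\to[m]$ with $\tau(j)<\tau(j')$ iff $\pi(i_j)<\pi(i_{j'})$. The density $d(\sigma,\pi)$ of $\sigma$ in $\pi$ (with $|\pi|\ge|\sigma|$) is the probability that $|\sigma|$ uniformly random distinct points of $[|\pi|]$ induce $\sigma$. A permutation $\sigma$ of order $m$ is layered if $[m]$ can be partitioned into consecutive intervals $I_1,\ldots,I_k$ (in order) such that $\sigma$ is decreasing on each $I_j$ and $\sigma(x)<\sigma(x')$ whenever $x\in I_j$, $x'\in I_{j'}$, $j<j'$; the $I_j$ are its layers, and $\sigma$ is called the layered permutation with layers of sizes $(|I_1|,\ldots,|I_k|)$. The packing density of $\sigma$ is $\lim_{n\to\infty}\max\{d(\sigma,\pi): |\pi|=n\}$. A sequence $(\pi_m)_{m\in\mathbb{N}}$ of permutations is near-$\sigma$-optimal if $|\pi_m|\to\infty$ and $d(\sigma,\pi_m)$ converges to the packing density of $\sigma$. -}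

module Defs where

open import Data.Nat using (ℕ; zero; suc; _+_; _∸_; _<ᵇ_; _≤_; _<_)
open import Data.Nat.Combinatorics using (_C_)
open import Data.Fin using (Fin; toℕ)
open import Data.Fin.Permutation using (Permutation′; _⟨$⟩ʳ_)
open import Data.Bool using (Bool; if_then_else_; not; _xor_)
open import Data.List using (List; []; _∷_; [_]; map; _++_; length; filterᵇ; allFin)
open import Data.Bool.ListAction using (all)
open import Data.Nat.ListAction using (sum)
open import Data.List.Relation.Unary.All using (All)
open import Data.Vec using (Vec; lookup) renaming ([] to []ᵥ; _∷_ to _∷ᵥ_)
open import Data.Integer using (+_)
open import Data.Rational using (ℚ; _/_; 0ℚ; _-_; ∣_∣) renaming (_≤_ to _≤ℚ_; _<_ to _<ℚ_)
open import Data.Product using (Σ; ∃; _×_)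
open import Relation.Binary.PropositionalEquality using (_≡_)

choose : {A : Set} (k : ℕ) → List A → List (Vec A k)
choose zero    xs       = [ []ᵥ ]
choose (suc k) []       = []
choose (suc k) (x ∷ xs) = map (x ∷ᵥ_) (choose k xs) ++ choose (suc k) xs

-- Do the points i₁ < … < i_k (given increasingly in v) induce σ in π ?
induces : {k n : ℕ} → Permutation′ k → Permutation′ n → Vec (Fin n) k → Bool
induces {k} σ π v =
  all (λ j → all (λ j′ →
        not ((toℕ (σ ⟨$⟩ʳ j) <ᵇ toℕ (σ ⟨$⟩ʳ j′))
             xor (toℕ (π ⟨$⟩ʳ lookup v j) <ᵇ toℕ (π ⟨$⟩ʳ lookup v j′))))
      (allFin k)) (allFin k)

occurrences : {k n : ℕ} → Permutation′ k → Permutation′ n → ℕ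
occurrences {k} {n} σ π = length (filterᵇ (induces σ π) (choose k (allFin n)))

-- c / d as a rational (d = 0 only happens when |π| < |σ|, where the value 0 is junk)
frac : ℕ → ℕ → ℚ
frac c zero    = 0ℚ
frac c (suc d) = (+ c) / suc d

density : {k n : ℕ} → Permutation′ k → Permutation′ n → ℚ
density {k} {n} σ π = frac (occurrences σ π) (n C k)

IsMaxDensity : {k : ℕ} → Permutation′ k → ℕ → ℚ → Set
IsMaxDensity σ n q = (∃ λ (π : Permutation′ n) → density σ π ≡ q)
                   × (∀ (π : Permutation′ n) → density σ π ≤ℚ q)

layeredVal : List ℕ → ℕ → ℕ
layeredVal []       i = i
layeredVal (s ∷ ls) i = if i <ᵇ s then s ∸ 1 ∸ i else s + layeredVal ls (i ∸ s)

HasLayers : {n : ℕ} → Permutation′ n → List ℕ → Set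
HasLayers {n} π ls = All (0 <_) ls × sum ls ≡ n
                   × (∀ (i : Fin n) → toℕ (π ⟨$⟩ʳ i) ≡ layeredVal ls (toℕ i))

IsLayered : {n : ℕ} → Permutation′ n → Set
IsLayered π = ∃ λ ls → HasLayers π ls

-- (π_m) with |π_m| = size m is near-σ-optimal:
-- |π_m| → ∞ and d(σ, π_m) → packing density of σ = lim_n max_{|π|=n} d(σ, π)
-- (convergence to the limit of the maxima stated jointly, without reals).
NearOptimal : {k : ℕ} → Permutation′ k → (size : ℕ → ℕ) → ((m : ℕ) → Permutation′ (size m)) → Set
NearOptimal σ size π =
  (∀ (L : ℕ) → ∃ λ N → ∀ m → N ≤ m → L ≤ size m)
  × (∀ (ε : ℚ) → 0ℚ <ℚ ε → ∃ λ N → ∀ m n → N ≤ m → N ≤ n → ∀ q →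
       IsMaxDensity σ n q → ∣ density σ (π m) - q ∣ ≤ℚ ε)

{-# OPTIONS --safe #-}
module Submission where

-- A layer of a layered pattern embeds into a single layer, so the occurrences of the
-- pattern with layers p₁, …, p_k in the layered permutation with layers x₁, …, x_t number
-- Σ_{j₁<…<j_k} Π C(x_{jᵢ}, pᵢ), to leading order W(x) / Π pᵢ! with W(x) = Σ Π x_{jᵢ}^{pᵢ}.
-- It therefore suffices to improve every configuration with at most t layers by a fixed
-- relative amount. By induction on t, a layer of negligible mass may be dropped; otherwise
-- one layer is halved. For the pattern (n,1) halving the last layer destroys nothing. For
-- (n,1,ℓ₁,…) and n large, a configuration of nearly optimal density has one layer with at
-- least 3/4 of the mass; merging all earlier layers into it does not decrease W, and
-- halving the next layer w then creates about w^{1+ℓ₁} new occurrences per choice of the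
-- remaining points while destroying only about w^n.

open import Defs
open import Algebra.Properties.AbelianGroup using (xyx⁻¹≈y; ⁻¹-anti-homo‿-)
open import Data.Bool as Bool using (Bool; true; false; not; _xor_; _∧_; T?; if_then_else_)
open import Data.Bool.ListAction using (all)
open import Data.Fin using (Fin; zero; suc; toℕ; fromℕ<)
import Data.Fin as Fin
import Data.Fin.Properties as Fin
open import Data.Fin.Permutation using (Permutation′; permutation; _⟨$⟩ʳ_)
import Data.Integer as ℤ
import Data.Integer.Properties as ℤ
open import Data.List using (List; []; _∷_; _++_; length; map; replicate; filterᵇ; tabulate; allFin; initLast; _∷ʳ′_)
open import Data.List.Properties using (length-++; length-filter; map-++; map-∘; map-tabulate)
open import Data.List.Relation.Unary.All using (All; []; _∷_)
import Data.List.Relation.Unary.All as All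
import Data.List.Relation.Unary.All.Properties as All
open import Data.List.Relation.Unary.AllPairs using (AllPairs; []; _∷_)
import Data.List.Relation.Unary.AllPairs.Properties as AllPairs
open import Data.Nat
open import Data.Nat.Combinatorics using (_C_; nC1≡n; nCk+nC[k+1]≡[n+1]C[k+1])
open import Data.Nat.ListAction using (sum; product)
open import Data.Nat.ListAction.Properties using (sum-++)
open import Data.Nat.Properties
open import Data.Nat.Tactic.RingSolver using (solve-∀)
open import Data.Product using (∃; ∃₂; _×_; _,_; proj₁; proj₂)
open import Data.Rational as ℚ using (ℚ; 0ℚ; toℚᵘ)
import Data.Rational.Properties as ℚ
open import Data.Rational.Unnormalised as ℚᵘ using (mkℚᵘ; *≤*; *<*)
import Data.Rational.Unnormalised.Properties as ℚᵘ
open import Data.Sum using (_⊎_; inj₁; inj₂)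
open import Data.Vec as Vec using (Vec; []; _∷_; lookup; toList)
open import Data.Vec.Properties using (lookup-map)
open import Function using (_∘_; id)
open import Relation.Binary using (tri<; tri≈; tri>)
open import Relation.Binary.PropositionalEquality
open import Relation.Nullary using (¬_; yes; no; contradiction)
open import Relation.Nullary.Decidable using (decidable-stable)

-- The relative gain has to be uniform over all configurations with at most t layers. In place of
-- compactness the induction carries explicit constants, and refining the unit of mass keeps all
-- masses natural numbers. The fraction 3/4 arises as follows. Let N be the total mass and s the
-- order of the pattern. A first layer of mass 7N/8 followed by equal layers gives W at least
-- (7/8)^n N^s up to a factor independent of n, whereas configurations all of whose layers have mass
-- at most 3N/4 give at most (3/4)^n N^s up to such a factor. For n large the second loses. Merging
-- is what makes halving cheap. The layer w becomes the second one, so an occurrence that meets w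
-- either has its first layer inside w, which accounts for the cost of order w^n, or has only its
-- layer of size 1 there; the number of the latter is linear in w and survives halving. Without
-- merging, w could also contain the layer of size ℓ₁, and halving would thin out those occurrences.

-- Rational densities as fractions of natural numbers

∣p-q∣≤ε⇒q≤p+ε : ∀ p q ε → ℚ.∣ p ℚ.- q ∣ ℚ.≤ ε → q ℚ.≤ p ℚ.+ ε
∣p-q∣≤ε⇒q≤p+ε p q ε h with ℚ.∣p∣≡p∨∣p∣≡-p (p ℚ.- q)
... | inj₁ eq = begin
  q                          ≡⟨ ℚ.+-identityʳ q ⟨
  q ℚ.+ 0ℚ                   ≤⟨ ℚ.+-monoʳ-≤ q (subst (0ℚ ℚ.≤_) eq (ℚ.0≤∣p∣ (p ℚ.- q))) ⟩
  q ℚ.+ (p ℚ.- q)            ≡⟨ trans (sym (ℚ.+-assoc q p (ℚ.- q))) (xyx⁻¹≈y ℚ.+-0-abelianGroup q p) ⟩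
  p                          ≡⟨ ℚ.+-identityʳ p ⟨
  p ℚ.+ 0ℚ                   ≤⟨ ℚ.+-monoʳ-≤ p (ℚ.≤-trans (ℚ.0≤∣p∣ (p ℚ.- q)) h) ⟩
  p ℚ.+ ε                    ∎
  where open ℚ.≤-Reasoning
... | inj₂ eq = begin
  q                          ≡⟨ trans (sym (ℚ.+-assoc p q (ℚ.- p))) (xyx⁻¹≈y ℚ.+-0-abelianGroup p q) ⟨
  p ℚ.+ (q ℚ.- p)            ≡⟨ cong (p ℚ.+_) (⁻¹-anti-homo‿- ℚ.+-0-abelianGroup p q) ⟨
  p ℚ.+ ℚ.- (p ℚ.- q)        ≡⟨ cong (p ℚ.+_) eq ⟨
  p ℚ.+ ℚ.∣ p ℚ.- q ∣        ≤⟨ ℚ.+-monoʳ-≤ p h ⟩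
  p ℚ.+ ε                    ∎
  where open ℚ.≤-Reasoning

toℚᵘ-frac : ∀ c d → toℚᵘ (frac c (suc d)) ℚᵘ.≃ mkℚᵘ (ℤ.+ c) d
toℚᵘ-frac c d = ℚ.toℚᵘ-fromℚᵘ (mkℚᵘ (ℤ.+ c) d)

frac-mono : ∀ d {c c′} → c ≤ c′ → frac c d ℚ.≤ frac c′ d
frac-mono zero    c≤c′ = ℚ.≤-refl
frac-mono (suc d) {c} {c′} c≤c′ = ℚ.toℚᵘ-cancel-≤ (begin
  toℚᵘ (frac c (suc d))   ≃⟨ toℚᵘ-frac c d ⟩
  mkℚᵘ (ℤ.+ c) d            ≤⟨ *≤* (ℤ.*-monoʳ-≤-nonNeg (ℤ.+ suc d) (ℤ.+≤+ c≤c′)) ⟩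
  mkℚᵘ (ℤ.+ c′) d           ≃⟨ toℚᵘ-frac c′ d ⟨
  toℚᵘ (frac c′ (suc d))  ∎)
  where open ℚᵘ.≤-Reasoning

frac>0 : ∀ d → 0ℚ ℚ.< frac 1 (suc d)
frac>0 d = ℚ.toℚᵘ-cancel-< (ℚᵘ.<-respʳ-≃ (ℚᵘ.≃-sym (toℚᵘ-frac 1 d)) (*<* (ℤ.+<+ z<s)))

frac-≤-+ : ∀ {o′ c′ o c e} → 0 < c′ → 0 < c → 0 < e → frac o′ c′ ℚ.≤ frac o c ℚ.+ frac 1 e →
           o′ * (c * e) ≤ (o * e + c) * c′
frac-≤-+ {o′} {suc c′} {o} {suc c} {suc e} _ _ _ h =
  ≤-trans (ℤ.drop‿+≤+ (subst₂ ℤ._≤_ (sym (ℤ.pos-* o′ (suc c * suc e))) eq (ℚᵘ.drop-*≤* step)))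
          (≤-reflexive (cong (λ z → (o * suc e + z) * suc c′) (*-identityˡ (suc c))))
  where
  open ℚᵘ.≤-Reasoning
  step : mkℚᵘ (ℤ.+ o′) c′ ℚᵘ.≤ mkℚᵘ (ℤ.+ o) c ℚᵘ.+ mkℚᵘ (ℤ.+ 1) e
  step = begin
    mkℚᵘ (ℤ.+ o′) c′                                            ≃⟨ toℚᵘ-frac o′ c′ ⟨
    toℚᵘ (frac o′ (suc c′))                                   ≤⟨ ℚ.toℚᵘ-mono-≤ h ⟩
    toℚᵘ (frac o (suc c) ℚ.+ frac 1 (suc e))                  ≃⟨ ℚ.toℚᵘ-homo-+ (frac o (suc c)) (frac 1 (suc e)) ⟩
    toℚᵘ (frac o (suc c)) ℚᵘ.+ toℚᵘ (frac 1 (suc e))          ≃⟨ ℚᵘ.+-cong (toℚᵘ-frac o c) (toℚᵘ-frac 1 e) ⟩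
    mkℚᵘ (ℤ.+ o) c ℚᵘ.+ mkℚᵘ (ℤ.+ 1) e                            ∎
  eq : ((ℤ.+ o ℤ.* ℤ.+ suc e) ℤ.+ (ℤ.+ 1 ℤ.* ℤ.+ suc c)) ℤ.* ℤ.+ suc c′ ≡ ℤ.+ ((o * suc e + 1 * suc c) * suc c′)
  eq = trans (cong (ℤ._* ℤ.+ suc c′) (trans (cong₂ ℤ._+_ (sym (ℤ.pos-* o (suc e))) (sym (ℤ.pos-* 1 (suc c)))) refl))
             (sym (ℤ.pos-* (o * suc e + 1 * suc c) (suc c′)))

open ≤-Reasoning

-- Inequalities for powers

^-pos : ∀ {x} n → 1 ≤ x → 1 ≤ x ^ n
^-pos {x} n 1≤x = m^n>0 x {{>-nonZero 1≤x}} n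

*-pos : ∀ {x y} → 0 < x → 0 < y → 0 < x * y
*-pos = *-mono-< {0} {_} {0}

^-distribʳ-* : ∀ x y p → (x * y) ^ p ≡ x ^ p * y ^ p
^-distribʳ-* x y zero    = refl
^-distribʳ-* x y (suc p) = trans (cong (x * y *_) (^-distribʳ-* x y p)) (lem x y (x ^ p) (y ^ p))
  where
  lem : ∀ x y a b → x * y * (a * b) ≡ x * a * (y * b)
  lem = solve-∀

^-superadditive : ∀ x y p → x ^ suc p + y ^ suc p ≤ (x + y) ^ suc p
^-superadditive x y p = begin
  x * x ^ p + y * y ^ p              ≤⟨ +-mono-≤ (*-monoʳ-≤ x (^-monoˡ-≤ p (m≤m+n x y)))
                                                  (*-monoʳ-≤ y (^-monoˡ-≤ p (m≤n+m y x))) ⟩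
  x * (x + y) ^ p + y * (x + y) ^ p  ≡⟨ *-distribʳ-+ ((x + y) ^ p) x y ⟨
  (x + y) ^ suc p                    ∎

-- Bernoulli's inequality (1 + 1/A)^n ≥ 1 + n/A, cleared of denominators. It turns every "n large
-- enough" below into an explicit linear condition.
^-eventually-dominates : ∀ A K n → .{{NonZero A}} → K * A ≤ n → K * A ^ n ≤ suc A ^ n
^-eventually-dominates A K n KA≤n = *-cancelˡ-≤ A (begin
  A * (K * A ^ n)    ≡⟨ lem A K (A ^ n) ⟩
  A ^ n * (K * A)    ≤⟨ *-monoʳ-≤ (A ^ n) (≤-trans KA≤n (m≤n+m n A)) ⟩
  A ^ n * (A + n)    ≤⟨ bernoulli n ⟩
  A * suc A ^ n      ∎)
  where
  lem : ∀ A K x → A * (K * x) ≡ x * (K * A)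
  lem = solve-∀
  lem₁ : ∀ A x n → A * x * (A + suc n) + x * n ≡ suc A * (x * (A + n))
  lem₁ = solve-∀
  bernoulli : ∀ n → A ^ n * (A + n) ≤ A * suc A ^ n
  bernoulli zero    = ≤-reflexive (base A)
    where
    base : ∀ A → 1 * (A + 0) ≡ A * 1
    base = solve-∀
  bernoulli (suc n) = begin
    A * A ^ n * (A + suc n)              ≤⟨ m≤m+n _ (A ^ n * n) ⟩
    A * A ^ n * (A + suc n) + A ^ n * n  ≡⟨ lem₁ A (A ^ n) n ⟩
    suc A * (A ^ n * (A + n))            ≤⟨ *-monoʳ-≤ (suc A) (bernoulli n) ⟩
    suc A * (A * suc A ^ n)              ≡⟨ lem₂ A (suc A ^ n) ⟩
    A * suc A ^ suc n                    ∎
    where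
    lem₂ : ∀ A x → suc A * (A * x) ≡ A * (suc A * x)
    lem₂ = solve-∀

-- The leading-order count `W` and its estimates

-- The homogeneous polynomial Σ_{j₁<…<j_k} x_{j₁}^{p₁} ⋯ x_{j_k}^{p_k}.
W : List ℕ → List ℕ → ℕ
W []       xs       = 1
W (p ∷ ps) []       = 0
W (p ∷ ps) (x ∷ xs) = x ^ p * W ps xs + W (p ∷ ps) xs

W-scale : ∀ c ps xs → W ps (map (c *_) xs) ≡ c ^ sum ps * W ps xs
W-scale c []       xs       = refl
W-scale c (p ∷ ps) []       = sym (*-zeroʳ (c ^ (p + sum ps)))
W-scale c (p ∷ ps) (x ∷ xs) = begin-equality
  (c * x) ^ p * W ps (map (c *_) xs) + W (p ∷ ps) (map (c *_) xs)
    ≡⟨ cong₂ _+_ (cong₂ _*_ (^-distribʳ-* c x p) (W-scale c ps xs)) (W-scale c (p ∷ ps) xs) ⟩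
  c ^ p * x ^ p * (c ^ sum ps * W ps xs) + c ^ (p + sum ps) * W (p ∷ ps) xs
    ≡⟨ cong₂ _+_ (lem (c ^ p) (x ^ p) (c ^ sum ps) (W ps xs)) refl ⟩
  c ^ p * c ^ sum ps * (x ^ p * W ps xs) + c ^ (p + sum ps) * W (p ∷ ps) xs
    ≡⟨ cong (λ z → z * (x ^ p * W ps xs) + c ^ (p + sum ps) * W (p ∷ ps) xs) (^-distribˡ-+-* c p (sum ps)) ⟨
  c ^ (p + sum ps) * (x ^ p * W ps xs) + c ^ (p + sum ps) * W (p ∷ ps) xs
    ≡⟨ *-distribˡ-+ (c ^ (p + sum ps)) _ _ ⟨
  c ^ (p + sum ps) * (x ^ p * W ps xs + W (p ∷ ps) xs) ∎
  where
  lem : ∀ a b c d → a * b * (c * d) ≡ a * c * (b * d)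
  lem = solve-∀

sum-scale : ∀ c xs → sum (map (c *_) xs) ≡ c * sum xs
sum-scale c []       = sym (*-zeroʳ c)
sum-scale c (x ∷ xs) = trans (cong (c * x +_) (sum-scale c xs)) (sym (*-distribˡ-+ c x (sum xs)))

W-mono-∷ : ∀ ps x xs → W ps xs ≤ W ps (x ∷ xs)
W-mono-∷ []       x xs = ≤-refl
W-mono-∷ (p ∷ ps) x xs = m≤n+m _ _

-- Forgetting that the first pattern layer must precede the others lets it range over all parts, and
-- superadditivity of the power collapses the resulting power sum.
W-peel : ∀ p ps xs → W (suc p ∷ ps) xs ≤ sum xs ^ suc p * W ps xs
W-peel p ps []       = z≤n
W-peel p ps (x ∷ xs) = begin
  x ^ suc p * W ps xs + W (suc p ∷ ps) xs        ≤⟨ +-monoʳ-≤ (x ^ suc p * W ps xs) (W-peel p ps xs) ⟩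
  x ^ suc p * W ps xs + sum xs ^ suc p * W ps xs ≡⟨ *-distribʳ-+ (W ps xs) (x ^ suc p) (sum xs ^ suc p) ⟨
  (x ^ suc p + sum xs ^ suc p) * W ps xs         ≤⟨ *-mono-≤ (^-superadditive x (sum xs) p) (W-mono-∷ ps x xs) ⟩
  sum (x ∷ xs) ^ suc p * W ps (x ∷ xs)           ∎

W-bound : ∀ {ps} → All (1 ≤_) ps → ∀ xs → W ps xs ≤ sum xs ^ sum ps
W-bound []                     xs = ≤-refl
W-bound {suc p ∷ ps} (_ ∷ pos) xs = begin
  W (suc p ∷ ps) xs             ≤⟨ W-peel p ps xs ⟩
  sum xs ^ suc p * W ps xs      ≤⟨ *-monoʳ-≤ (sum xs ^ suc p) (W-bound pos xs) ⟩
  sum xs ^ suc p * sum xs ^ sum ps ≡⟨ ^-distribˡ-+-* (sum xs) (suc p) (sum ps) ⟨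
  sum xs ^ (suc p + sum ps)     ∎

W-bound-≤ : ∀ {ps} → All (1 ≤_) ps → ∀ xs {N} → sum xs ≤ N → W ps xs ≤ N ^ sum ps
W-bound-≤ {ps} pos xs xs≤N = ≤-trans (W-bound pos xs) (^-monoˡ-≤ (sum ps) xs≤N)

W-replicate : ∀ ps N → N ^ sum ps ≤ W ps (replicate (length ps) N)
W-replicate []       N = ≤-refl
W-replicate (p ∷ ps) N = begin
  N ^ (p + sum ps)                        ≡⟨ ^-distribˡ-+-* N p (sum ps) ⟩
  N ^ p * N ^ sum ps                      ≤⟨ *-monoʳ-≤ (N ^ p) (W-replicate ps N) ⟩
  N ^ p * W ps (replicate (length ps) N)  ≤⟨ m≤m+n _ _ ⟩
  W (p ∷ ps) (replicate (suc (length ps)) N) ∎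

sum-replicate : ∀ k N → sum (replicate k N) ≡ k * N
sum-replicate zero    N = refl
sum-replicate (suc k) N = cong (N +_) (sum-replicate k N)

-- The two terms correspond to the first pattern layer lying in `as`, with the rest bounded crudely,
-- and in `bs`, which then contains everything.
W-++ : ∀ {ps} → All (1 ≤_) ps → ∀ p as bs {N} → sum (as ++ bs) ≤ N →
       W (suc p ∷ ps) (as ++ bs) ≤ sum as ^ suc p * N ^ sum ps + W (suc p ∷ ps) bs
W-++ pos p []       bs ≤N = ≤-refl
W-++ {ps} pos p (a ∷ as) bs {N} ≤N = begin
  a ^ suc p * W ps (as ++ bs) + W (suc p ∷ ps) (as ++ bs)
    ≤⟨ +-mono-≤ (*-monoʳ-≤ (a ^ suc p) (W-bound-≤ pos (as ++ bs) ≤N′)) (W-++ pos p as bs ≤N′) ⟩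
  a ^ suc p * N ^ sum ps + (sum as ^ suc p * N ^ sum ps + W (suc p ∷ ps) bs)
    ≡⟨ lem (a ^ suc p) (sum as ^ suc p) (N ^ sum ps) (W (suc p ∷ ps) bs) ⟩
  (a ^ suc p + sum as ^ suc p) * N ^ sum ps + W (suc p ∷ ps) bs
    ≤⟨ +-monoˡ-≤ _ (*-monoˡ-≤ (N ^ sum ps) (^-superadditive a (sum as) p)) ⟩
  (a + sum as) ^ suc p * N ^ sum ps + W (suc p ∷ ps) bs ∎
  where
  ≤N′ = m+n≤o⇒n≤o a ≤N
  lem : ∀ a b c d → a * c + (b * c + d) ≡ (a + b) * c + d
  lem = solve-∀

-- Of the `suc p` factors `x` of the first layer, one is kept and adds up to the mass; each of the
-- other `p` costs a factor 3/4. This is the exponential saving in the first layer's size.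
W-small-parts : ∀ {ps} → All (1 ≤_) ps → ∀ p xs {N} → sum xs ≤ N → All (λ x → 4 * x ≤ 3 * N) xs →
                4 ^ p * W (suc p ∷ ps) xs ≤ (3 * N) ^ p * N ^ sum ps * sum xs
W-small-parts pos p []       ≤N [] = ≤-trans (≤-reflexive (*-zeroʳ (4 ^ p))) z≤n
W-small-parts {ps} pos p (x ∷ xs) {N} ≤N (sm ∷ sms) = begin
  4 ^ p * (x * x ^ p * W ps xs + W (suc p ∷ ps) xs)
    ≡⟨ lem (4 ^ p) x (x ^ p) (W ps xs) (W (suc p ∷ ps) xs) ⟩
  4 ^ p * x ^ p * W ps xs * x + 4 ^ p * W (suc p ∷ ps) xs
    ≡⟨ cong (λ z → z * W ps xs * x + 4 ^ p * W (suc p ∷ ps) xs) (^-distribʳ-* 4 x p) ⟨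
  (4 * x) ^ p * W ps xs * x + 4 ^ p * W (suc p ∷ ps) xs
    ≤⟨ +-mono-≤ (*-monoˡ-≤ x (*-mono-≤ (^-monoˡ-≤ p sm) (W-bound-≤ pos xs ≤N′)))
                (W-small-parts pos p xs ≤N′ sms) ⟩
  (3 * N) ^ p * N ^ sum ps * x + (3 * N) ^ p * N ^ sum ps * sum xs
    ≡⟨ *-distribˡ-+ ((3 * N) ^ p * N ^ sum ps) x (sum xs) ⟨
  (3 * N) ^ p * N ^ sum ps * (x + sum xs) ∎
  where
  ≤N′ = m+n≤o⇒n≤o x ≤N
  lem : ∀ f x y w v → f * (x * y * w + v) ≡ f * y * w * x + f * v
  lem = solve-∀

-- A bound for the partial derivatives of W ps at points of total mass S.
V : List ℕ → ℕ → ℕ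
V []       S = 0
V (p ∷ ps) S = S ^ pred p * S ^ sum ps + S ^ p * V ps S

V-mono : ∀ ps {S T} → S ≤ T → V ps S ≤ V ps T
V-mono []       S≤T = z≤n
V-mono (p ∷ ps) S≤T = +-mono-≤ (*-mono-≤ (^-monoˡ-≤ (pred p) S≤T) (^-monoˡ-≤ (sum ps) S≤T))
                               (*-mono-≤ (^-monoˡ-≤ p S≤T) (V-mono ps S≤T))

-- Each pattern layer contributes one term of degree `sum ps - 1` to `V`; multiplying by `S` avoids
-- the predecessor in the exponent.
V-bound : ∀ {ps} → All (1 ≤_) ps → ∀ S → S * V ps S ≤ length ps * S ^ sum ps
V-bound []                     S = ≤-reflexive (*-zeroʳ S)
V-bound {suc p ∷ ps} (_ ∷ pos) S = begin
  S * (S ^ p * S ^ sum ps + S * S ^ p * V ps S)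
    ≡⟨ lem S (S ^ p) (S ^ sum ps) (V ps S) ⟩
  S * S ^ p * (S ^ sum ps + S * V ps S)
    ≤⟨ *-monoʳ-≤ (S * S ^ p) (+-monoʳ-≤ (S ^ sum ps) (V-bound pos S)) ⟩
  S ^ suc p * (suc (length ps) * S ^ sum ps)
    ≡⟨ lem₁ (S ^ suc p) (suc (length ps)) (S ^ sum ps) ⟩
  suc (length ps) * (S ^ suc p * S ^ sum ps)
    ≡⟨ cong (suc (length ps) *_) (^-distribˡ-+-* S (suc p) (sum ps)) ⟨
  suc (length ps) * S ^ (suc p + sum ps) ∎
  where
  lem : ∀ S a b v → S * (a * b + S * a * v) ≡ S * a * (b + S * v)
  lem = solve-∀
  lem₁ : ∀ a b c → a * (b * c) ≡ b * (a * c)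
  lem₁ = solve-∀

-- Every lost term has a factor `x`. The induction on `as` closes because the powers of the skipped
-- parts add up, by superadditivity, inside the power of the total mass.
W-drop : ∀ {ps} → All (1 ≤_) ps → ∀ as x bs →
         W ps (as ++ x ∷ bs) ≤ W ps (as ++ bs) + x * V ps (sum (as ++ x ∷ bs))
W-drop [] as x bs = m≤m+n _ _
W-drop {suc p ∷ ps} (_ ∷ pos) [] x bs = begin
  x ^ suc p * W ps bs + W (suc p ∷ ps) bs
    ≡⟨ +-comm (x ^ suc p * W ps bs) _ ⟩
  W (suc p ∷ ps) bs + x * x ^ p * W ps bs
    ≤⟨ +-monoʳ-≤ (W (suc p ∷ ps) bs) (begin
      x * x ^ p * W ps bs         ≡⟨ *-assoc x (x ^ p) (W ps bs) ⟩
      x * (x ^ p * W ps bs)       ≤⟨ *-monoʳ-≤ x (*-mono-≤ (^-monoˡ-≤ p (m≤m+n x (sum bs)))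
                                                           (W-bound-≤ pos bs (m≤n+m (sum bs) x))) ⟩
      x * (S ^ p * S ^ sum ps)    ≤⟨ *-monoʳ-≤ x (m≤m+n _ _) ⟩
      x * V (suc p ∷ ps) S        ∎) ⟩
  W (suc p ∷ ps) bs + x * V (suc p ∷ ps) S ∎
  where S = x + sum bs
W-drop {suc p ∷ ps} (q ∷ pos) (a ∷ as) x bs = begin
  a ^ suc p * W ps (as ++ x ∷ bs) + W (suc p ∷ ps) (as ++ x ∷ bs)
    ≤⟨ +-mono-≤ (*-monoʳ-≤ (a ^ suc p) (W-drop pos as x bs)) (W-drop (q ∷ pos) as x bs) ⟩
  a ^ suc p * (u + x * v) + (w + x * (T ^ p * T ^ sum ps + T ^ suc p * v))
    ≡⟨ lem (a ^ suc p) u x v w (T ^ p * T ^ sum ps) (T ^ suc p) ⟩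
  a ^ suc p * u + w + x * (T ^ p * T ^ sum ps + (a ^ suc p + T ^ suc p) * v)
    ≤⟨ +-monoʳ-≤ (a ^ suc p * u + w) (*-monoʳ-≤ x (+-mono-≤
         (*-mono-≤ (^-monoˡ-≤ p T≤S) (^-monoˡ-≤ (sum ps) T≤S))
         (*-mono-≤ (^-superadditive a T p) (V-mono ps T≤S)))) ⟩
  a ^ suc p * u + w + x * (S ^ p * S ^ sum ps + S ^ suc p * V ps S) ∎
  where
  T = sum (as ++ x ∷ bs)
  S = a + T
  T≤S = m≤n+m T a
  u = W ps (as ++ bs)
  v = V ps T
  w = W (suc p ∷ ps) (as ++ bs)
  lem : ∀ a u x v w t y → a * (u + x * v) + (w + x * (t + y * v)) ≡ a * u + w + x * (t + (a + y) * v)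
  lem = solve-∀

-- From improving one part to a uniform relative gap

-- The masses ys are measured in units D times finer than xs, which rescales W by D ^ sum ps.
Beaten : List ℕ → ℕ → ℕ → List ℕ → Set
Beaten ps E g xs = ∃₂ λ ys D → 0 < D × sum ys ≡ D * sum xs ×
                     D ^ sum ps * (E * W ps xs + g) ≤ E * W ps ys

-- The list `as ++ x ∷ bs` leaves room for merging layers before a part `x` is singled out.
-- Modifying `x` gains only in proportion to `x ^ sum ps`, possibly negligible against the total; in
-- that case it is `x` that gets dropped.
ImprovableAt : List ℕ → ℕ → List ℕ → Set
ImprovableAt ps E xs = ∃₂ λ as x → ∃ λ bs →
  length (as ++ x ∷ bs) ≤ length xs × sum (as ++ x ∷ bs) ≡ sum xs ×
  W ps xs ≤ W ps (as ++ x ∷ bs) × Beaten ps E (x ^ sum ps) xs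

Improvable : List ℕ → ℕ → Set
Improvable ps E = ∀ xs → 0 < sum xs → ImprovableAt ps E xs

-- Gain and `W` are homogeneous of the same degree, so one `E` serves lists of every total mass.
Gap : List ℕ → ℕ → ℕ → Set
Gap ps t E = ∀ xs → length xs ≤ t → 0 < sum xs → Beaten ps E (sum xs ^ sum ps) xs

Beaten-weaken : ∀ ps E c {g h} xs → h ≤ c * g → Beaten ps E g xs → Beaten ps (c * E) h xs
Beaten-weaken ps E c {g} {h} xs h≤cg (ys , D , D>0 , eq , le) = ys , D , D>0 , eq , (begin
  D ^ sum ps * (c * E * W ps xs + h)       ≤⟨ *-monoʳ-≤ (D ^ sum ps) (+-monoʳ-≤ (c * E * W ps xs) h≤cg) ⟩
  D ^ sum ps * (c * E * W ps xs + c * g)   ≡⟨ lem (D ^ sum ps) c E (W ps xs) g ⟩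
  c * (D ^ sum ps * (E * W ps xs + g))     ≤⟨ *-monoʳ-≤ c le ⟩
  c * (E * W ps ys)                        ≡⟨ *-assoc c E (W ps ys) ⟨
  c * E * W ps ys                          ∎)
  where
  lem : ∀ d c e w g → d * (c * e * w + c * g) ≡ c * (d * (e * w + g))
  lem = solve-∀

ImprovableAt-weaken : ∀ ps E c xs → 0 < c → ImprovableAt ps E xs → ImprovableAt ps (c * E) xs
ImprovableAt-weaken ps E c xs c>0 (as , x , bs , len , eq , le , beaten) =
  as , x , bs , len , eq , le , Beaten-weaken ps E c xs (m≤n*m (x ^ sum ps) c {{>-nonZero c>0}}) beaten

module _ {ps : List ℕ} (pos : All (1 ≤_) ps) (E₀ : ℕ) (E₀>0 : 0 < E₀) (H : Improvable ps E₀) where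

  private s = sum ps

  -- The ratio of total mass to `x` beyond which `x` is negligible. The product controls the loss in
  -- `W`; the summand `2` leaves at least half of the mass after `x` is dropped.
  scaleOf : ℕ → ℕ
  scaleOf E = E * 2 ^ suc s * length ps + 2

  -- The product of the constants of the two cases, not their maximum, so that each case reaches it
  -- through `Beaten-weaken` with an integer factor.
  gapConst : ℕ → ℕ
  gapConst zero    = 1
  gapConst (suc t) = E₀ * scaleOf E ^ s * (2 ^ suc s * E)
    where E = gapConst t

  -- Dropping a part x ≪ N loses less than half of the gap known for shorter lists.
  drop-ineq : ∀ E N T x w v w′ → x * scaleOf E ≤ N → T + x ≡ N → N * v ≤ length ps * N ^ s → w ≤ w′ + x * v → 0 < N →
              2 ^ suc s * E * w + N ^ s ≤ 2 ^ suc s * (E * w′ + T ^ s)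
  drop-ineq E N T x w v w′ xB≤N T+x≡N Nv≤ w≤ N>0 = begin
    2 ^ suc s * E * w + N ^ s
      ≤⟨ +-monoˡ-≤ (N ^ s) (*-monoʳ-≤ (2 ^ suc s * E) w≤) ⟩
    2 ^ suc s * E * (w′ + x * v) + N ^ s
      ≡⟨ lem (2 ^ suc s) E w′ (x * v) (N ^ s) ⟩
    2 ^ suc s * E * w′ + (E * 2 ^ suc s * (x * v) + N ^ s)
      ≤⟨ +-monoʳ-≤ (2 ^ suc s * E * w′) (+-mono-≤ small (^-monoˡ-≤ s N≤2T)) ⟩
    2 ^ suc s * E * w′ + ((2 * T) ^ s + (2 * T) ^ s)
      ≡⟨ cong (λ z → 2 ^ suc s * E * w′ + (z + z)) (^-distribʳ-* 2 T s) ⟩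
    2 ^ suc s * E * w′ + (2 ^ s * T ^ s + 2 ^ s * T ^ s)
      ≡⟨ lem₁ (2 ^ s) E w′ (T ^ s) ⟩
    2 ^ suc s * (E * w′ + T ^ s) ∎
    where
    lem : ∀ d e w z n → d * e * (w + z) + n ≡ d * e * w + (e * d * z + n)
    lem = solve-∀
    lem₁ : ∀ d e w n → 2 * d * e * w + (d * n + d * n) ≡ 2 * d * (e * w + n)
    lem₁ = solve-∀
    lem₂ : ∀ x c → x + x + x * c ≡ x * (c + 2)
    lem₂ = solve-∀
    lem₃ : ∀ n d x v → n * (d * (x * v)) ≡ d * x * (n * v)
    lem₃ = solve-∀
    lem₄ : ∀ d x c m → d * x * (c * m) ≡ x * (d * c) * m
    lem₄ = solve-∀
    x+x≤N : x + x ≤ N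
    x+x≤N = ≤-trans (≤-trans (m≤m+n _ (x * (E * 2 ^ suc s * length ps))) (≤-reflexive (lem₂ x _))) xB≤N
    x≤T : x ≤ T
    x≤T = +-cancelʳ-≤ x x T (≤-trans x+x≤N (≤-reflexive (sym T+x≡N)))
    N≤2T : N ≤ 2 * T
    N≤2T = begin
      N       ≡⟨ T+x≡N ⟨
      T + x   ≤⟨ +-monoʳ-≤ T x≤T ⟩
      T + T   ≡⟨ cong (T +_) (+-identityʳ T) ⟨
      2 * T   ∎
    small : E * 2 ^ suc s * (x * v) ≤ (2 * T) ^ s
    small = ≤-trans (*-cancelˡ-≤ N {{>-nonZero N>0}} (begin
      N * (E * 2 ^ suc s * (x * v))             ≡⟨ lem₃ N (E * 2 ^ suc s) x v ⟩
      E * 2 ^ suc s * x * (N * v)               ≤⟨ *-monoʳ-≤ (E * 2 ^ suc s * x) Nv≤ ⟩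
      E * 2 ^ suc s * x * (length ps * N ^ s)   ≡⟨ lem₄ (E * 2 ^ suc s) x (length ps) (N ^ s) ⟩
      x * (E * 2 ^ suc s * length ps) * N ^ s   ≤⟨ *-monoˡ-≤ (N ^ s) (≤-trans (*-monoʳ-≤ x (m≤m+n _ 2)) xB≤N) ⟩
      N * N ^ s                                 ∎)) (^-monoˡ-≤ s N≤2T)

  sum-drop : ∀ as x bs → sum (as ++ bs) + x ≡ sum (as ++ x ∷ bs)
  sum-drop as x bs = trans (cong (_+ x) (sum-++ as bs))
    (trans (lem (sum as) (sum bs) x) (sym (sum-++ as (x ∷ bs))))
    where
    lem : ∀ a b x → a + b + x ≡ a + (x + b)
    lem = solve-∀

  length-drop : ∀ as x bs → suc (length (as ++ bs)) ≡ length {A = ℕ} (as ++ x ∷ bs)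
  length-drop []       x bs = refl
  length-drop (a ∷ as) x bs = cong suc (length-drop as x bs)

  gapConst>0 : ∀ t → 0 < gapConst t
  gapConst>0 zero    = z<s
  gapConst>0 (suc t) = *-pos (*-pos E₀>0 (m^n>0 B {{>-nonZero B>0}} s))
                                            (*-pos (m^n>0 2 (suc s)) (gapConst>0 t))
    where
    B = scaleOf (gapConst t)
    B>0 : 0 < B
    B>0 = ≤-trans z<s (m≤n+m 2 (gapConst t * 2 ^ suc s * length ps))

  Gap-gapConst : ∀ t → Gap ps t (gapConst t)
  Gap-gapConst zero    []       _   ()
  Gap-gapConst (suc t) xs len≤ N>0
    with H xs N>0
  ... | as , x , bs , len′ , sum′ , W′ , beaten
    with sum xs ≤? x * scaleOf (gapConst t)
  -- Here `x` is a fixed fraction of the mass, so the gain `x ^ s` is already of order `sum xs ^ s`.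
  ... | yes N≤xB = subst (λ e → Beaten ps e (sum xs ^ s) xs) (lem E₀ (B ^ s) (2 ^ suc s) E)
                     (Beaten-weaken ps (B ^ s * E₀) (2 ^ suc s * E) xs
                       (m≤n*m (sum xs ^ s) (2 ^ suc s * E) {{>-nonZero c>0}})
                       (Beaten-weaken ps E₀ (B ^ s) xs N^s≤ beaten))
    where
    E = gapConst t
    B = scaleOf E
    lem : ∀ e b d f → d * f * (b * e) ≡ e * b * (d * f)
    lem = solve-∀
    c>0 : 0 < 2 ^ suc s * E
    c>0 = *-pos (m^n>0 2 (suc s)) (gapConst>0 t)
    N^s≤ : sum xs ^ s ≤ B ^ s * x ^ s
    N^s≤ = begin
      sum xs ^ s     ≤⟨ ^-monoˡ-≤ s N≤xB ⟩
      (x * B) ^ s    ≡⟨ ^-distribʳ-* x B s ⟩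
      x ^ s * B ^ s  ≡⟨ *-comm (x ^ s) (B ^ s) ⟩
      B ^ s * x ^ s  ∎
  ... | no N≰xB
    with Gap-gapConst t (as ++ bs) len-t T>0
    where
    len-t : length (as ++ bs) ≤ t
    len-t = s≤s⁻¹ (≤-trans (≤-reflexive (length-drop as x bs)) (≤-trans len′ len≤))
    T>0 : 0 < sum (as ++ bs)
    T>0 = n≢0⇒n>0 λ T≡0 → N≰xB (begin
      sum xs                          ≡⟨ sum′ ⟨
      sum (as ++ x ∷ bs)              ≡⟨ sum-drop as x bs ⟨
      sum (as ++ bs) + x              ≡⟨ cong (_+ x) T≡0 ⟩
      x                               ≤⟨ m≤m*n x (scaleOf (gapConst t)) {{>-nonZero (≤-trans z<s (m≤n+m 2 _))}} ⟩
      x * scaleOf (gapConst t)        ∎)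
  ... | ys , D , D>0 , sum-ys , le =
    Beaten-weaken ps (2 ^ suc s * E) (E₀ * B ^ s) xs
      (m≤n*m (N ^ s) (E₀ * B ^ s) {{>-nonZero (*-pos E₀>0 (m^n>0 B {{>-nonZero (≤-trans z<s (m≤n+m 2 _))}} s))}})
      -- The dropped mass returns as an additional part, which cannot decrease `W`.
      (D * x ∷ ys , D , D>0 , sum-eq , (begin
        D ^ s * (2 ^ suc s * E * W ps xs + N ^ s)
          ≤⟨ *-monoʳ-≤ (D ^ s) (drop-ineq E N T x (W ps xs) (V ps N) (W ps (as ++ bs)) (<⇒≤ (≰⇒> N≰xB))
               T+x≡N (V-bound pos N) W≤ N>0) ⟩
        D ^ s * (2 ^ suc s * (E * W ps (as ++ bs) + T ^ s))
          ≡⟨ lem (D ^ s) (2 ^ suc s) _ ⟩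
        2 ^ suc s * (D ^ s * (E * W ps (as ++ bs) + T ^ s))
          ≤⟨ *-monoʳ-≤ (2 ^ suc s) (≤-trans le (*-monoʳ-≤ E (W-mono-∷ ps (D * x) ys))) ⟩
        2 ^ suc s * (E * W ps (D * x ∷ ys))
          ≡⟨ *-assoc (2 ^ suc s) E _ ⟨
        2 ^ suc s * E * W ps (D * x ∷ ys) ∎))
    where
    E = gapConst t
    B = scaleOf E
    N = sum xs
    T = sum (as ++ bs)
    T+x≡N : T + x ≡ N
    T+x≡N = trans (sum-drop as x bs) sum′
    sum-eq : D * x + sum ys ≡ D * N
    sum-eq = trans (cong (D * x +_) sum-ys) (trans (sym (*-distribˡ-+ D x T)) (cong (D *_) (trans (+-comm x T) T+x≡N)))
    W≤ : W ps xs ≤ W ps (as ++ bs) + x * V ps N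
    W≤ = ≤-trans W′ (subst (λ z → W ps (as ++ x ∷ bs) ≤ W ps (as ++ bs) + x * V ps z) sum′ (W-drop pos as x bs))
    lem : ∀ a b c → a * (b * c) ≡ b * (a * c)
    lem = solve-∀

-- The pattern (n,1)

W-1 : ∀ xs → W (1 ∷ []) xs ≡ sum xs
W-1 []       = refl
W-1 (x ∷ xs) = cong₂ _+_ (lem x) (W-1 xs)
  where
  lem : ∀ x → x * 1 * 1 ≡ x
  lem = solve-∀

module _ (n : ℕ) where

  private
    p = suc n
    ps : List ℕ
    ps = p ∷ 1 ∷ []
    s = sum ps

  -- The last part can only contain the final layer of size 1, whose count is linear and is
  -- unchanged by splitting. The new term `x ^ s` takes the first layer in one half and the single
  -- point in the other.
  split-last : ∀ as x → 2 ^ s * W ps (as ++ x ∷ []) + x ^ s ≤ W ps (map (2 *_) as ++ x ∷ x ∷ [])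
  split-last [] x = ≤-reflexive (trans (cong (λ z → 2 ^ s * (x ^ p * 0 + 0) + z) (^-distribˡ-+-* x p 1))
    (lem (2 ^ s) (x ^ p) x))
    where
    lem : ∀ d y x → d * (y * 0 + 0) + y * (x * 1) ≡ y * (x * 1 * 1 + 0) + (y * 0 + 0)
    lem = solve-∀
  split-last (a ∷ as) x = begin
    2 ^ s * (a ^ p * W (1 ∷ []) (as ++ x ∷ []) + W ps (as ++ x ∷ [])) + x ^ s
      ≡⟨ lem (2 ^ s) (a ^ p * W (1 ∷ []) (as ++ x ∷ [])) (W ps (as ++ x ∷ [])) (x ^ s) ⟩
    2 ^ s * (a ^ p * W (1 ∷ []) (as ++ x ∷ [])) + (2 ^ s * W ps (as ++ x ∷ []) + x ^ s)
      ≤⟨ +-mono-≤ (≤-reflexive first) (split-last as x) ⟩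
    (2 * a) ^ p * W (1 ∷ []) (map (2 *_) as ++ x ∷ x ∷ []) + W ps (map (2 *_) as ++ x ∷ x ∷ []) ∎
    where
    lem : ∀ d a b c → d * (a + b) + c ≡ d * a + (d * b + c)
    lem = solve-∀
    lem₁ : ∀ u v c w → u * (v * 1) * (c * w) ≡ u * c * (v * w)
    lem₁ = solve-∀
    lem₂ : ∀ u x → 2 * (u + (x + 0)) ≡ 2 * u + (x + (x + 0))
    lem₂ = solve-∀
    doubled : 2 * W (1 ∷ []) (as ++ x ∷ []) ≡ W (1 ∷ []) (map (2 *_) as ++ x ∷ x ∷ [])
    doubled = begin-equality
      2 * W (1 ∷ []) (as ++ x ∷ [])             ≡⟨ cong (2 *_) (trans (W-1 (as ++ x ∷ [])) (sum-++ as (x ∷ []))) ⟩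
      2 * (sum as + (x + 0))                    ≡⟨ lem₂ (sum as) x ⟩
      2 * sum as + (x + (x + 0))                ≡⟨ cong (_+ (x + (x + 0))) (sum-scale 2 as) ⟨
      sum (map (2 *_) as) + (x + (x + 0))       ≡⟨ trans (W-1 (map (2 *_) as ++ x ∷ x ∷ [])) (sum-++ (map (2 *_) as) _) ⟨
      W (1 ∷ []) (map (2 *_) as ++ x ∷ x ∷ []) ∎
    first : 2 ^ s * (a ^ p * W (1 ∷ []) (as ++ x ∷ [])) ≡ (2 * a) ^ p * W (1 ∷ []) (map (2 *_) as ++ x ∷ x ∷ [])
    first = begin-equality
      2 ^ s * (a ^ p * W (1 ∷ []) (as ++ x ∷ []))
        ≡⟨ cong (_* (a ^ p * W (1 ∷ []) (as ++ x ∷ []))) (^-distribˡ-+-* 2 p 1) ⟩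
      2 ^ p * 2 * (a ^ p * W (1 ∷ []) (as ++ x ∷ []))
        ≡⟨ lem₁ (2 ^ p) 2 (a ^ p) _ ⟩
      2 ^ p * a ^ p * (2 * W (1 ∷ []) (as ++ x ∷ []))
        ≡⟨ cong₂ _*_ (sym (^-distribʳ-* 2 a p)) doubled ⟩
      (2 * a) ^ p * W (1 ∷ []) (map (2 *_) as ++ x ∷ x ∷ []) ∎

  improvable-n-1 : ∃ λ E → 0 < E × Improvable ps E
  improvable-n-1 = 2 ^ s , m^n>0 2 s , split-last-improves
    where
    split-last-improves : Improvable ps (2 ^ s)
    split-last-improves xs N>0 with initLast xs
    split-last-improves .[] ()  | []
    split-last-improves .(as ++ y ∷ []) _ | as ∷ʳ′ y = as , y , [] , ≤-refl , refl , ≤-refl ,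
      map (2 *_) as ++ y ∷ y ∷ [] , 2 , z<s , sum-eq , *-monoʳ-≤ (2 ^ s) (split-last as y)
      where
      lem : ∀ u x → 2 * u + (x + (x + 0)) ≡ 2 * (u + (x + 0))
      lem = solve-∀
      sum-eq : sum (map (2 *_) as ++ y ∷ y ∷ []) ≡ 2 * sum (as ++ y ∷ [])
      sum-eq = begin-equality
        sum (map (2 *_) as ++ y ∷ y ∷ [])     ≡⟨ sum-++ (map (2 *_) as) _ ⟩
        sum (map (2 *_) as) + (y + (y + 0))   ≡⟨ cong (_+ (y + (y + 0))) (sum-scale 2 as) ⟩
        2 * sum as + (y + (y + 0))            ≡⟨ lem (sum as) y ⟩
        2 * (sum as + (y + 0))                ≡⟨ cong (2 *_) (sum-++ as (y ∷ [])) ⟨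
        2 * sum (as ++ y ∷ [])                ∎

-- The patterns (n,1,ℓ,…)

large-part? : ∀ N xs → All (λ x → 4 * x ≤ 3 * N) xs ⊎ ∃₂ λ as x → ∃ λ bs → xs ≡ as ++ x ∷ bs × 3 * N ≤ 4 * x
large-part? N []       = inj₁ []
large-part? N (x ∷ xs) with 4 * x ≤? 3 * N | large-part? N xs
... | no  ≰  | _                              = inj₂ ([] , x , xs , refl , <⇒≤ (≰⇒> ≰))
... | yes _  | inj₂ (as , y , bs , eq , big)  = inj₂ (x ∷ as , y , bs , cong (x ∷_) eq , big)
... | yes sm | inj₁ sms                       = inj₁ (sm ∷ sms)

module _ (n l : ℕ) (ls : List ℕ) (pos : All (1 ≤_) ls) where

  private
    p = suc n
    ℓ = suc l
    ps₂ ps₁ ps : List ℕ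
    ps₂ = ℓ ∷ ls
    ps₁ = 1 ∷ ps₂
    ps  = p ∷ ps₁
    q = sum ls
    m = sum ps₁
    s = sum ps
    r = length ps₁
    D = 8 * r
    pos₁ : All (1 ≤_) ps₁
    pos₁ = s≤s z≤n ∷ s≤s z≤n ∷ pos

  -- The factor `D ^ m` is the price of the short layers in the reference configuration, and `2`
  -- stands for "at least half as good". The value involves only the pattern layers after the first,
  -- which is what allows the first to be chosen large afterwards.
  K : ℕ
  K = 2 * D ^ m

  private
    K>0 : 0 < K
    K>0 = *-pos {2} z<s (^-pos m (s≤s z≤n))

  private
    P = W ps
    R = W ps₁

  -- The better configuration is one part with 7/8 of the mass followed by equal parts.
  reference-beats : ∀ x xs → 0 < sum (x ∷ xs) → 2 * D ^ s * P (x ∷ xs) ≤ (7 * r) ^ p * sum (x ∷ xs) ^ s →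
                    Beaten ps (2 * D ^ s) (x ^ s) (x ∷ xs)
  reference-beats x xs N>0 h = 7 * r * N ∷ replicate r N , D , z<s , sum-eq , (begin
    D ^ s * (2 * D ^ s * P (x ∷ xs) + x ^ s)  ≤⟨ *-monoʳ-≤ (D ^ s) (+-mono-≤ h x^s≤) ⟩
    D ^ s * (A * N ^ s + A * N ^ s)           ≡⟨ lem (D ^ s) (A * N ^ s) ⟩
    2 * D ^ s * (A * N ^ s)                   ≤⟨ *-monoʳ-≤ (2 * D ^ s) W≥ ⟩
    2 * D ^ s * P (7 * r * N ∷ replicate r N) ∎)
    where
    N = sum (x ∷ xs)
    A = (7 * r) ^ p
    lem : ∀ d z → d * (z + z) ≡ 2 * d * z
    lem = solve-∀
    lem₁ : ∀ r N → 7 * r * N + r * N ≡ 8 * r * N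
    lem₁ = solve-∀
    sum-eq : 7 * r * N + sum (replicate r N) ≡ D * N
    sum-eq = trans (cong (7 * r * N +_) (sum-replicate r N)) (lem₁ r N)
    x^s≤ : x ^ s ≤ A * N ^ s
    x^s≤ = ≤-trans (^-monoˡ-≤ s (m≤m+n x (sum xs))) (m≤n*m (N ^ s) A {{>-nonZero (^-pos p (s≤s z≤n))}})
    W≥ : A * N ^ s ≤ P (7 * r * N ∷ replicate r N)
    W≥ = begin
      A * N ^ (p + m)               ≡⟨ cong (A *_) (^-distribˡ-+-* N p m) ⟩
      A * (N ^ p * N ^ m)           ≡⟨ *-assoc A (N ^ p) (N ^ m) ⟨
      A * N ^ p * N ^ m             ≡⟨ cong (_* N ^ m) (^-distribʳ-* (7 * r) N p) ⟨
      (7 * r * N) ^ p * N ^ m       ≤⟨ *-monoʳ-≤ ((7 * r * N) ^ p) (W-replicate ps₁ N) ⟩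
      (7 * r * N) ^ p * R (replicate r N) ≤⟨ m≤m+n _ _ ⟩
      P (7 * r * N ∷ replicate r N) ∎

  -- Since `D` is `8 * r`, cancelling `r ^ p` leaves the bare ratio (7/8)^p; the remaining
  -- `2 * D ^ m` is `K`.
  reference-bound : ∀ N P → (7 * r) ^ p * N ^ s ≤ 2 * D ^ s * P → 7 ^ p * N ^ s ≤ K * 8 ^ p * P
  reference-bound N P h = *-cancelˡ-≤ (r ^ p) {{>-nonZero (^-pos p (s≤s z≤n))}} (begin
    r ^ p * (7 ^ p * N ^ s)              ≡⟨ lem (r ^ p) (7 ^ p) (N ^ s) ⟩
    7 ^ p * r ^ p * N ^ s                ≡⟨ cong (_* N ^ s) (^-distribʳ-* 7 r p) ⟨
    (7 * r) ^ p * N ^ s                  ≤⟨ h ⟩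
    2 * D ^ (p + m) * P                  ≡⟨ cong (λ z → 2 * z * P) (trans (^-distribˡ-+-* D p m) (cong (_* D ^ m) (^-distribʳ-* 8 r p))) ⟩
    2 * (8 ^ p * r ^ p * D ^ m) * P      ≡⟨ lem₁ (8 ^ p) (r ^ p) (D ^ m) P ⟩
    r ^ p * (K * 8 ^ p * P)              ∎)
    where
    lem : ∀ r a b → r * (a * b) ≡ a * r * b
    lem = solve-∀
    lem₁ : ∀ e r d P → 2 * (e * r * d) * P ≡ r * (2 * d * e * P)
    lem₁ = solve-∀

  -- A lower bound of order (7/8)^n meets the upper bound of order (3/4)^n from `W-small-parts`.
  -- Over a common denominator the bases are 28 = 7 * 4 and 24 = 8 * 3; the intermediate 25 is the
  -- successor required by `^-eventually-dominates`.
  ¬small-parts : 8 * K * 24 ^ n ≤ 25 ^ n → ∀ xs → 0 < sum xs → 7 ^ p * sum xs ^ s ≤ K * 8 ^ p * P xs →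
                 ¬ All (λ x → 4 * x ≤ 3 * sum xs) xs
  ¬small-parts c xs N>0 h small = n≮n (7 * 28 ^ n) (begin-strict
    7 * 28 ^ n         ≤⟨ *-cancelˡ-≤ (N ^ s) {{>-nonZero (^-pos s N>0)}} main ⟩
    8 * K * 24 ^ n     ≤⟨ c ⟩
    25 ^ n             ≤⟨ ^-monoˡ-≤ n (m≤m+n 25 3) ⟩
    28 ^ n             <⟨ m<m+n (28 ^ n) (*-pos {6} z<s (^-pos {28} n (s≤s z≤n))) ⟩
    7 * 28 ^ n         ∎)
    where
    N = sum xs
    lem : ∀ N v f → N * (7 * (v * f)) ≡ f * (7 * v * N)
    lem = solve-∀
    lem₁ : ∀ f k e P → f * (k * (8 * e) * P) ≡ 8 * k * e * (f * P)
    lem₁ = solve-∀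
    lem₂ : ∀ k e t a b c → 8 * k * e * (t * a * b * c) ≡ c * a * b * (8 * k * (e * t))
    lem₂ = solve-∀
    main : N ^ s * (7 * 28 ^ n) ≤ N ^ s * (8 * K * 24 ^ n)
    main = begin
      N ^ s * (7 * 28 ^ n)                     ≡⟨ cong (λ z → N ^ s * (7 * z)) (^-distribʳ-* 7 4 n) ⟩
      N ^ s * (7 * (7 ^ n * 4 ^ n))            ≡⟨ lem (N ^ s) (7 ^ n) (4 ^ n) ⟩
      4 ^ n * (7 ^ p * N ^ s)                  ≤⟨ *-monoʳ-≤ (4 ^ n) h ⟩
      4 ^ n * (K * 8 ^ p * P xs)               ≡⟨ lem₁ (4 ^ n) K (8 ^ n) (P xs) ⟩
      8 * K * 8 ^ n * (4 ^ n * P xs)           ≤⟨ *-monoʳ-≤ (8 * K * 8 ^ n) (W-small-parts pos₁ n xs ≤-refl small) ⟩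
      8 * K * 8 ^ n * ((3 * N) ^ n * N ^ m * N) ≡⟨ cong (λ z → 8 * K * 8 ^ n * (z * N ^ m * N)) (^-distribʳ-* 3 N n) ⟩
      8 * K * 8 ^ n * (3 ^ n * N ^ n * N ^ m * N) ≡⟨ lem₂ K (8 ^ n) (3 ^ n) (N ^ n) (N ^ m) N ⟩
      N ^ p * N ^ m * (8 * K * (8 ^ n * 3 ^ n)) ≡⟨ cong₂ (λ a b → a * (8 * K * b)) (sym (^-distribˡ-+-* N p m)) (sym (^-distribʳ-* 8 3 n)) ⟩
      N ^ s * (8 * K * 24 ^ n) ∎

  -- Here `x` is the large part, `y` and `z` are the masses before and after it, and `R₁` is the
  -- count of the remaining pattern layers in the parts after it.
  module Merge (x y z N P₁ R₁ : ℕ) (N>0 : 0 < N) (x≤N : x ≤ N) (4y≤N : 4 * y ≤ N) (4z≤N : 4 * z ≤ N)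
    (3N≤4x : 3 * N ≤ 4 * x)
    (h : 7 ^ p * N ^ s ≤ K * 8 ^ p * P₁)
    (P≤ : P₁ ≤ y ^ p * N ^ m + (x ^ p * R₁ + z ^ p * N ^ m)) where

    ^-scaled : ∀ {y} → 4 * y ≤ N → ∀ n → 4 ^ n * y ^ n ≤ N ^ n
    ^-scaled {y} le n = ≤-trans (≤-reflexive (sym (^-distribʳ-* 4 y n))) (^-monoˡ-≤ n le)

    -- As `y` and `z` are at most N/4, their two terms together are, by the hypothesis on `K`, at
    -- most half of the lower bound (7/8)^p N^s / K. The term `x ^ p * R₁` must supply the other
    -- half.
    tail-bound : 4 * K * 8 ^ p ≤ 28 ^ p → 7 ^ p * N ^ m ≤ 2 * K * 8 ^ p * R₁
    tail-bound c = *-cancelˡ-≤ (4 ^ p * N ^ p) {{>-nonZero (*-pos (^-pos {4} p (s≤s z≤n)) (^-pos p N>0))}}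
      (≤-trans (+-cancelˡ-≤ G G _ two) (≤-trans (*-monoʳ-≤ (2 * K * 8 ^ p * 4 ^ p) (*-monoˡ-≤ R₁ (^-monoˡ-≤ p x≤N)))
        (≤-reflexive (lem₃ K (8 ^ p) (4 ^ p) (N ^ p) R₁))))
      where
      G = 4 ^ p * N ^ p * (7 ^ p * N ^ m)
      lem : ∀ f a v b → f * a * (v * b) + f * a * (v * b) ≡ 2 * (f * (v * (a * b)))
      lem = solve-∀
      lem₁ : ∀ k e f y b x r z → 2 * (f * (k * e * (y * b + (x * r + z * b)))) ≡ 2 * k * e * b * (f * y + f * z) + 2 * k * e * f * (x * r)
      lem₁ = solve-∀
      lem₂ : ∀ k e a b → 2 * k * e * b * (a + a) ≡ a * b * (4 * k * e)
      lem₂ = solve-∀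
      lem₃ : ∀ k e f a r → 2 * k * e * f * (a * r) ≡ f * a * (2 * k * e * r)
      lem₃ = solve-∀
      lem₄ : ∀ a b v f → a * b * (v * f) ≡ f * a * (v * b)
      lem₄ = solve-∀
      two : G + G ≤ G + 2 * K * 8 ^ p * 4 ^ p * (x ^ p * R₁)
      two = begin
        G + G
          ≡⟨ lem (4 ^ p) (N ^ p) (7 ^ p) (N ^ m) ⟩
        2 * (4 ^ p * (7 ^ p * (N ^ p * N ^ m)))
          ≡⟨ cong (λ z → 2 * (4 ^ p * (7 ^ p * z))) (^-distribˡ-+-* N p m) ⟨
        2 * (4 ^ p * (7 ^ p * N ^ s))
          ≤⟨ *-monoʳ-≤ 2 (*-monoʳ-≤ (4 ^ p) (≤-trans h (*-monoʳ-≤ (K * 8 ^ p) P≤))) ⟩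
        2 * (4 ^ p * (K * 8 ^ p * (y ^ p * N ^ m + (x ^ p * R₁ + z ^ p * N ^ m))))
          ≡⟨ lem₁ K (8 ^ p) (4 ^ p) (y ^ p) (N ^ m) (x ^ p) R₁ (z ^ p) ⟩
        2 * K * 8 ^ p * N ^ m * (4 ^ p * y ^ p + 4 ^ p * z ^ p) + 2 * K * 8 ^ p * 4 ^ p * (x ^ p * R₁)
          ≤⟨ +-monoˡ-≤ _ (*-monoʳ-≤ (2 * K * 8 ^ p * N ^ m) (+-mono-≤ (^-scaled {y} 4y≤N p) (^-scaled {z} 4z≤N p))) ⟩
        2 * K * 8 ^ p * N ^ m * (N ^ p + N ^ p) + 2 * K * 8 ^ p * 4 ^ p * (x ^ p * R₁)
          ≡⟨ cong (_+ 2 * K * 8 ^ p * 4 ^ p * (x ^ p * R₁)) (lem₂ K (8 ^ p) (N ^ p) (N ^ m)) ⟩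
        N ^ p * N ^ m * (4 * K * 8 ^ p) + 2 * K * 8 ^ p * 4 ^ p * (x ^ p * R₁)
          ≤⟨ +-monoˡ-≤ _ (*-monoʳ-≤ (N ^ p * N ^ m) c) ⟩
        N ^ p * N ^ m * 28 ^ p + 2 * K * 8 ^ p * 4 ^ p * (x ^ p * R₁)
          ≡⟨ cong (_+ 2 * K * 8 ^ p * 4 ^ p * (x ^ p * R₁)) (trans (cong (N ^ p * N ^ m *_) (^-distribʳ-* 7 4 p)) (lem₄ (N ^ p) (N ^ m) (7 ^ p) (4 ^ p))) ⟩
        G + 2 * K * 8 ^ p * 4 ^ p * (x ^ p * R₁) ∎

    -- Moving `y` into `x` trades the arbitrary continuation `N ^ m` for `R₁`, which is smaller by a
    -- factor of order (7/8)^p at worst; the ratio (y/x)^n ≤ 3^(-n) outweighs this.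
    merge-gain : 7 ^ p * N ^ m ≤ 2 * K * 8 ^ p * R₁ → 2 * K * 8 ^ p ≤ 3 ^ n * 7 ^ p →
                 y ^ p * N ^ m + x ^ p * R₁ ≤ (y + x) ^ p * R₁
    merge-gain tail c = begin
      y * y ^ n * N ^ m + x ^ p * R₁    ≡⟨ cong (_+ x ^ p * R₁) (*-assoc y (y ^ n) (N ^ m)) ⟩
      y * (y ^ n * N ^ m) + x ^ p * R₁  ≤⟨ +-monoˡ-≤ (x ^ p * R₁) (*-monoʳ-≤ y key) ⟩
      y * (x ^ n * R₁) + x * x ^ n * R₁ ≡⟨ lem y x (x ^ n) R₁ ⟩
      (y + x) * x ^ n * R₁              ≤⟨ *-monoˡ-≤ R₁ (*-monoʳ-≤ (y + x) (^-monoˡ-≤ n (m≤n+m x y))) ⟩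
      (y + x) * (y + x) ^ n * R₁        ∎
      where
      lem : ∀ y x a r → y * (a * r) + x * a * r ≡ (y + x) * a * r
      lem = solve-∀
      lem₁ : ∀ k e f y b → 2 * k * e * f * (y * b) ≡ 2 * k * e * b * (f * y)
      lem₁ = solve-∀
      lem₂ : ∀ t v b a → t * v * b * a ≡ t * a * (v * b)
      lem₂ = solve-∀
      lem₃ : ∀ f x k r → f * x * (k * r) ≡ k * f * (x * r)
      lem₃ = solve-∀
      key : y ^ n * N ^ m ≤ x ^ n * R₁
      key = *-cancelˡ-≤ (2 * K * 8 ^ p * 4 ^ n)
        {{>-nonZero (*-pos (*-pos (*-pos {2} z<s K>0) (^-pos {8} p (s≤s z≤n))) (^-pos {4} n (s≤s z≤n)))}} (begin
        2 * K * 8 ^ p * 4 ^ n * (y ^ n * N ^ m)    ≡⟨ lem₁ K (8 ^ p) (4 ^ n) (y ^ n) (N ^ m) ⟩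
        2 * K * 8 ^ p * N ^ m * (4 ^ n * y ^ n)    ≤⟨ *-mono-≤ (*-monoˡ-≤ (N ^ m) c) (^-scaled {y} 4y≤N n) ⟩
        3 ^ n * 7 ^ p * N ^ m * N ^ n              ≡⟨ lem₂ (3 ^ n) (7 ^ p) (N ^ m) (N ^ n) ⟩
        3 ^ n * N ^ n * (7 ^ p * N ^ m)            ≡⟨ cong (_* (7 ^ p * N ^ m)) (^-distribʳ-* 3 N n) ⟨
        (3 * N) ^ n * (7 ^ p * N ^ m)              ≤⟨ *-mono-≤ (^-monoˡ-≤ n 3N≤4x) tail ⟩
        (4 * x) ^ n * (2 * K * 8 ^ p * R₁)         ≡⟨ cong (_* (2 * K * 8 ^ p * R₁)) (^-distribʳ-* 4 x n) ⟩
        4 ^ n * x ^ n * (2 * K * 8 ^ p * R₁)       ≡⟨ lem₃ (4 ^ n) (x ^ n) (2 * K * 8 ^ p) R₁ ⟩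
        2 * K * 8 ^ p * 4 ^ n * (x ^ n * R₁)       ∎)

  module Split (X w N d : ℕ) (cs : List ℕ) (cs≤N : sum cs ≤ N) (4w≤N : 4 * w ≤ N) (3N≤4X : 3 * N ≤ 4 * X)
    (N>0 : 0 < N) (p≡ : p ≡ suc ℓ + d) where

    private
      Q  = W ps₂
      Q′ = W ls cs
      G  = 2 ^ p * X ^ p * (2 ^ q * (w ^ suc ℓ * Q′))
      loss = 2 ^ p * 2 ^ m * (w ^ p * R cs)

    halved : List ℕ
    halved = 2 * X ∷ w ∷ w ∷ map (2 *_) cs

    sum-halved : sum halved ≡ 2 * (X + (w + sum cs))
    sum-halved = trans (cong (λ z → 2 * X + (w + (w + z))) (sum-scale 2 cs)) (lem X w (sum cs))
      where
      lem : ∀ X w c → 2 * X + (w + (w + 2 * c)) ≡ 2 * (X + (w + c))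
      lem = solve-∀

    -- The factor `Q′` is retained because `G` has it too: loss and gain can then be compared
    -- however small `Q′` is.
    R-cs≤ : R cs ≤ N ^ suc ℓ * Q′
    R-cs≤ = begin
      R cs                                ≤⟨ W-peel 0 ps₂ cs ⟩
      sum cs ^ 1 * W ps₂ cs               ≤⟨ *-mono-≤ (^-monoˡ-≤ 1 cs≤N) (≤-trans (W-peel l ls cs) (*-monoˡ-≤ Q′ (^-monoˡ-≤ ℓ cs≤N))) ⟩
      N ^ 1 * (N ^ ℓ * Q′)                ≡⟨ lem N (N ^ ℓ) Q′ ⟩
      N ^ suc ℓ * Q′                      ∎
      where
      lem : ∀ N a b → N * 1 * (a * b) ≡ N * a * b
      lem = solve-∀

    R-w∷cs≤ : R (w ∷ cs) ≤ 2 * (N ^ suc ℓ * Q′)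
    R-w∷cs≤ = begin
      w ^ 1 * Q cs + R cs                 ≤⟨ +-mono-≤ (*-mono-≤ w^1≤N (≤-trans (W-peel l ls cs) (*-monoˡ-≤ Q′ (^-monoˡ-≤ ℓ cs≤N)))) R-cs≤ ⟩
      N * (N ^ ℓ * Q′) + N ^ suc ℓ * Q′   ≡⟨ lem N (N ^ ℓ) Q′ ⟩
      2 * (N ^ suc ℓ * Q′)                ∎
      where
      lem : ∀ N a b → N * (a * b) + N * a * b ≡ 2 * (N * a * b)
      lem = solve-∀
      w^1≤N : w ^ 1 ≤ N
      w^1≤N = ≤-trans (≤-reflexive (*-identityʳ w)) (≤-trans (m≤n*m w 4) 4w≤N)

    -- Halving w creates the new occurrences counted by G; the only ones destroyed
    -- are those taking the first layer of σ inside w.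
    halving : 2 ^ p * 2 ^ m * P (X ∷ w ∷ cs) + G ≤ P halved + loss
    halving = begin
      2 ^ p * 2 ^ m * (X ^ p * (w ^ 1 * Q cs + R cs) + (w ^ p * R cs + P cs)) + G
        ≡⟨ lem (2 ^ p) (2 ^ m) (X ^ p) (w ^ 1 * Q cs + R cs) (w ^ p * R cs) (P cs) (2 ^ q * (w ^ suc ℓ * Q′)) ⟩
      2 ^ p * X ^ p * (2 ^ m * (w ^ 1 * Q cs + R cs) + 2 ^ q * (w ^ suc ℓ * Q′)) + 2 ^ p * 2 ^ m * P cs + loss
        ≡⟨ cong (λ z → 2 ^ p * X ^ p * z + 2 ^ p * 2 ^ m * P cs + loss) R-eq ⟩
      2 ^ p * X ^ p * R (w ∷ w ∷ map (2 *_) cs) + 2 ^ p * 2 ^ m * P cs + loss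
        ≤⟨ +-monoˡ-≤ loss (+-mono-≤ (≤-reflexive (cong (_* R (w ∷ w ∷ map (2 *_) cs)) (sym (^-distribʳ-* 2 X p)))) P-le) ⟩
      P halved + loss ∎
      where
      lem : ∀ a b x r w c g → a * b * (x * r + (w + c)) + a * x * g ≡ a * x * (b * r + g) + a * b * c + a * b * w
      lem = solve-∀
      lem₁ : ∀ f g w v a b c → 2 * (f * g) * (w * 1 * b + c) + g * (w * v * a) ≡ w * 1 * (v * (g * a) + f * g * b) + (w * 1 * (f * g * b) + 2 * (f * g) * c)
      lem₁ = solve-∀
      -- An exact identity: after a first layer in `X`, the part `w` contains at most the layer of
      -- size 1, linear in `w`, so the two halves reproduce the old count. The extra term has the
      -- single point in one half and the layer `ℓ` in the other.
      R-eq : 2 ^ m * (w ^ 1 * Q cs + R cs) + 2 ^ q * (w ^ suc ℓ * Q′) ≡ R (w ∷ w ∷ map (2 *_) cs)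
      R-eq = begin-equality
        2 * 2 ^ (ℓ + q) * (w ^ 1 * Q cs + R cs) + 2 ^ q * (w ^ suc ℓ * Q′)
          ≡⟨ cong (λ z → 2 * z * (w ^ 1 * Q cs + R cs) + 2 ^ q * (w ^ suc ℓ * Q′)) (^-distribˡ-+-* 2 ℓ q) ⟩
        2 * (2 ^ ℓ * 2 ^ q) * (w ^ 1 * Q cs + R cs) + 2 ^ q * (w * w ^ ℓ * Q′)
          ≡⟨ lem₁ (2 ^ ℓ) (2 ^ q) w (w ^ ℓ) Q′ (Q cs) (R cs) ⟩
        w ^ 1 * (w ^ ℓ * (2 ^ q * Q′) + 2 ^ ℓ * 2 ^ q * Q cs) + (w ^ 1 * (2 ^ ℓ * 2 ^ q * Q cs) + 2 * (2 ^ ℓ * 2 ^ q) * R cs)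
          ≡⟨ cong (λ z → w ^ 1 * (w ^ ℓ * (2 ^ q * Q′) + z * Q cs) + (w ^ 1 * (z * Q cs) + 2 * z * R cs)) (^-distribˡ-+-* 2 ℓ q) ⟨
        w ^ 1 * (w ^ ℓ * (2 ^ q * Q′) + 2 ^ (ℓ + q) * Q cs) + (w ^ 1 * (2 ^ (ℓ + q) * Q cs) + 2 ^ m * R cs)
          ≡⟨ cong₂ (λ a b → w ^ 1 * (w ^ ℓ * a + b) + (w ^ 1 * b + 2 ^ m * R cs)) (W-scale 2 ls cs) (W-scale 2 ps₂ cs) ⟨
        w ^ 1 * (w ^ ℓ * W ls (map (2 *_) cs) + Q (map (2 *_) cs)) + (w ^ 1 * Q (map (2 *_) cs) + 2 ^ m * R cs)
          ≡⟨ cong (λ z → w ^ 1 * (w ^ ℓ * W ls (map (2 *_) cs) + Q (map (2 *_) cs)) + (w ^ 1 * Q (map (2 *_) cs) + z)) (W-scale 2 ps₁ cs) ⟨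
        R (w ∷ w ∷ map (2 *_) cs) ∎
      P-le : 2 ^ p * 2 ^ m * P cs ≤ P (w ∷ w ∷ map (2 *_) cs)
      P-le = begin
        2 ^ p * 2 ^ m * P cs   ≡⟨ cong (_* P cs) (^-distribˡ-+-* 2 p m) ⟨
        2 ^ s * P cs           ≡⟨ W-scale 2 ps cs ⟨
        P (map (2 *_) cs)      ≤⟨ ≤-trans (W-mono-∷ ps w (map (2 *_) cs)) (W-mono-∷ ps w (w ∷ map (2 *_) cs)) ⟩
        P (w ∷ w ∷ map (2 *_) cs) ∎

    -- After the common factor `w ^ suc ℓ` is removed, the loss retains `w ^ d` with w ≤ N/4,
    -- against `X ^ p` with X ≥ 3N/4. Clearing powers of 4 leaves exactly the condition
    -- `2 * 8 ^ suc ℓ ≤ 3 ^ p`.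
    loss≤ : 2 * 8 ^ suc ℓ ≤ 3 ^ p → 2 * loss ≤ G
    loss≤ c = begin
      2 * (2 ^ p * 2 ^ m * (w ^ p * R cs))
        ≤⟨ *-monoʳ-≤ 2 (*-monoʳ-≤ (2 ^ p * 2 ^ m) (*-monoʳ-≤ (w ^ p) R-cs≤)) ⟩
      2 * (2 ^ p * 2 ^ m * (w ^ p * (N ^ suc ℓ * Q′)))
        ≡⟨ cong₂ (λ a b → 2 * (2 ^ p * a * (b * (N ^ suc ℓ * Q′)))) (^-distribˡ-+-* 2 (suc ℓ) q) (trans (cong (w ^_) p≡) (^-distribˡ-+-* w (suc ℓ) d)) ⟩
      2 * (2 ^ p * (2 ^ suc ℓ * 2 ^ q) * (w ^ suc ℓ * w ^ d * (N ^ suc ℓ * Q′)))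
        ≡⟨ lem (2 ^ p) (2 ^ suc ℓ) (2 ^ q) (w ^ suc ℓ) (w ^ d) (N ^ suc ℓ) Q′ ⟩
      2 ^ p * (2 * 2 ^ suc ℓ * (w ^ d * N ^ suc ℓ)) * (2 ^ q * (w ^ suc ℓ * Q′))
        ≤⟨ *-monoˡ-≤ (2 ^ q * (w ^ suc ℓ * Q′)) (*-monoʳ-≤ (2 ^ p) key) ⟩
      G ∎
      where
      lem : ∀ a b g v u n Q → 2 * (a * (b * g) * (v * u * (n * Q))) ≡ a * (2 * b * (u * n)) * (g * (v * Q))
      lem = solve-∀
      lem₁ : ∀ a b c u n → a * b * (2 * c * (u * n)) ≡ 2 * (a * c) * (b * u * n)
      lem₁ = solve-∀
      key : 2 * 2 ^ suc ℓ * (w ^ d * N ^ suc ℓ) ≤ X ^ p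
      key = *-cancelˡ-≤ (4 ^ p) {{>-nonZero (^-pos {4} p (s≤s z≤n))}} (begin
        4 ^ p * (2 * 2 ^ suc ℓ * (w ^ d * N ^ suc ℓ))
          ≡⟨ cong (_* (2 * 2 ^ suc ℓ * (w ^ d * N ^ suc ℓ))) (trans (cong (4 ^_) p≡) (^-distribˡ-+-* 4 (suc ℓ) d)) ⟩
        4 ^ suc ℓ * 4 ^ d * (2 * 2 ^ suc ℓ * (w ^ d * N ^ suc ℓ))
          ≡⟨ lem₁ (4 ^ suc ℓ) (4 ^ d) (2 ^ suc ℓ) (w ^ d) (N ^ suc ℓ) ⟩
        2 * (4 ^ suc ℓ * 2 ^ suc ℓ) * (4 ^ d * w ^ d * N ^ suc ℓ)
          ≡⟨ cong₂ (λ a b → 2 * a * (b * N ^ suc ℓ)) (^-distribʳ-* 4 2 (suc ℓ)) (^-distribʳ-* 4 w d) ⟨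
        2 * 8 ^ suc ℓ * ((4 * w) ^ d * N ^ suc ℓ)
          ≤⟨ *-mono-≤ c (*-monoˡ-≤ (N ^ suc ℓ) (^-monoˡ-≤ d 4w≤N)) ⟩
        3 ^ p * (N ^ d * N ^ suc ℓ)
          ≡⟨ cong (3 ^ p *_) (trans (*-comm (N ^ d) _) (sym (trans (cong (N ^_) p≡) (^-distribˡ-+-* N (suc ℓ) d)))) ⟩
        3 ^ p * N ^ p
          ≡⟨ ^-distribʳ-* 3 N p ⟨
        (3 * N) ^ p
          ≤⟨ ^-monoˡ-≤ p 3N≤4X ⟩
        (4 * X) ^ p
          ≡⟨ ^-distribʳ-* 4 X p ⟩
        4 ^ p * X ^ p ∎)

    -- The tail bound forces `Q′` to be at least a constant times `N ^ q`, and `X` is a constant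
    -- fraction of `N`; what remains of `G` is `w ^ suc ℓ`, and w ≤ N.
    gain≥ : 7 ^ p * N ^ m ≤ 2 * K * 8 ^ p * R (w ∷ cs) → w ^ s ≤ 4 ^ p * (4 * K * 8 ^ p) * G
    gain≥ tail = begin
      w ^ (p + m)
        ≡⟨ trans (^-distribˡ-+-* w p m) (cong (w ^ p *_) (^-distribˡ-+-* w (suc ℓ) q)) ⟩
      w ^ p * (w ^ suc ℓ * w ^ q)
        ≤⟨ *-mono-≤ (^-monoˡ-≤ p w≤N) (*-monoʳ-≤ (w ^ suc ℓ) (≤-trans (^-monoˡ-≤ q w≤N) Nq≤)) ⟩
      N ^ p * (w ^ suc ℓ * (4 * K * 8 ^ p * Q′))
        ≤⟨ *-monoˡ-≤ (w ^ suc ℓ * (4 * K * 8 ^ p * Q′)) (^-monoˡ-≤ p (≤-trans (m≤n*m N 3) 3N≤4X)) ⟩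
      (4 * X) ^ p * (w ^ suc ℓ * (4 * K * 8 ^ p * Q′))
        ≡⟨ cong (_* (w ^ suc ℓ * (4 * K * 8 ^ p * Q′))) (^-distribʳ-* 4 X p) ⟩
      4 ^ p * X ^ p * (w ^ suc ℓ * (4 * K * 8 ^ p * Q′))
        ≤⟨ m≤n*m _ (2 ^ p * 2 ^ q) {{>-nonZero (*-pos (^-pos {2} p (s≤s z≤n)) (^-pos {2} q (s≤s z≤n)))}} ⟩
      2 ^ p * 2 ^ q * (4 ^ p * X ^ p * (w ^ suc ℓ * (4 * K * 8 ^ p * Q′)))
        ≡⟨ lem (2 ^ p) (2 ^ q) (4 ^ p) (X ^ p) (w ^ suc ℓ) (4 * K * 8 ^ p) Q′ ⟩
      4 ^ p * (4 * K * 8 ^ p) * G ∎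
      where
      lem : ∀ a b f x v k Q → a * b * (f * x * (v * (k * Q))) ≡ f * k * (a * x * (b * (v * Q)))
      lem = solve-∀
      lem₁ : ∀ n a b → n * (a * b) ≡ a * (n * b)
      lem₁ = solve-∀
      lem₂ : ∀ K e n Q → 2 * K * e * (2 * (n * Q)) ≡ n * (4 * K * e * Q)
      lem₂ = solve-∀
      w≤N : w ≤ N
      w≤N = ≤-trans (m≤n*m w 4) 4w≤N
      Nq≤ : N ^ q ≤ 4 * K * 8 ^ p * Q′
      Nq≤ = *-cancelˡ-≤ (N ^ suc ℓ) {{>-nonZero (^-pos (suc ℓ) N>0)}} (begin
        N ^ suc ℓ * N ^ q                     ≤⟨ m≤n*m _ (7 ^ p) {{>-nonZero (^-pos {7} p (s≤s z≤n))}} ⟩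
        7 ^ p * (N ^ suc ℓ * N ^ q)           ≡⟨ cong (7 ^ p *_) (^-distribˡ-+-* N (suc ℓ) q) ⟨
        7 ^ p * N ^ m                         ≤⟨ tail ⟩
        2 * K * 8 ^ p * R (w ∷ cs)            ≤⟨ *-monoʳ-≤ (2 * K * 8 ^ p) R-w∷cs≤ ⟩
        2 * K * 8 ^ p * (2 * (N ^ suc ℓ * Q′)) ≡⟨ lem₂ K (8 ^ p) (N ^ suc ℓ) Q′ ⟩
        N ^ suc ℓ * (4 * K * 8 ^ p * Q′)      ∎)

    split-gain : 7 ^ p * N ^ m ≤ 2 * K * 8 ^ p * R (w ∷ cs) → 2 * 8 ^ suc ℓ ≤ 3 ^ p →
                 ∀ {P₁} → P₁ ≤ P (X ∷ w ∷ cs) →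
                 2 ^ s * (2 ^ s * (2 * (4 ^ p * (4 * K * 8 ^ p))) * P₁ + w ^ s) ≤ 2 ^ s * (2 * (4 ^ p * (4 * K * 8 ^ p))) * P halved
    split-gain tail c {P₁} P₁≤ = begin
      2 ^ s * (2 ^ s * (2 * κ) * P₁ + w ^ s)
        ≤⟨ *-monoʳ-≤ (2 ^ s) (+-mono-≤ (*-monoʳ-≤ (2 ^ s * (2 * κ)) P₁≤) (gain≥ tail)) ⟩
      2 ^ s * (2 ^ s * (2 * κ) * P₂ + κ * G)
        ≡⟨ cong (λ z → 2 ^ s * z) (lem (2 ^ s) κ P₂ G) ⟩
      2 ^ s * (κ * (2 * (2 ^ s * P₂) + G))
        ≤⟨ *-monoʳ-≤ (2 ^ s) (*-monoʳ-≤ κ two) ⟩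
      2 ^ s * (κ * (2 * P halved))
        ≡⟨ lem₁ (2 ^ s) κ (P halved) ⟩
      2 ^ s * (2 * κ) * P halved ∎
      where
      κ = 4 ^ p * (4 * K * 8 ^ p)
      P₂ = P (X ∷ w ∷ cs)
      lem : ∀ d κ P G → d * (2 * κ) * P + κ * G ≡ κ * (2 * (d * P) + G)
      lem = solve-∀
      lem₁ : ∀ d κ P → d * (κ * (2 * P)) ≡ d * (2 * κ) * P
      lem₁ = solve-∀
      lem₂ : ∀ a g → 2 * a + g + g ≡ 2 * (a + g)
      lem₂ = solve-∀
      two : 2 * (2 ^ s * P₂) + G ≤ 2 * P halved
      two = +-cancelʳ-≤ G _ _ (begin
        2 * (2 ^ s * P₂) + G + G              ≡⟨ lem₂ (2 ^ s * P₂) G ⟩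
        2 * (2 ^ s * P₂ + G)                  ≡⟨ cong (λ z → 2 * (z * P₂ + G)) (^-distribˡ-+-* 2 p m) ⟩
        2 * (2 ^ p * 2 ^ m * P₂ + G)          ≤⟨ *-monoʳ-≤ 2 halving ⟩
        2 * (P halved + loss)                 ≡⟨ *-distribˡ-+ 2 (P halved) loss ⟩
        2 * P halved + 2 * loss               ≤⟨ +-monoʳ-≤ (2 * P halved) (loss≤ c) ⟩
        2 * P halved + G                      ∎)

  -- The summands serve, in order, the comparisons of exponentials involving `K`, the bound on the
  -- loss, and `suc ℓ ≤ p`, which makes the exponent `d` a true difference.
  threshold : ℕ
  threshold = 8 * K * 24 + 2 * 8 ^ suc ℓ + suc ℓ

  module _ (large : threshold ≤ n) where

    private
      192K≤ : 8 * K * 24 ≤ n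
      192K≤ = ≤-trans (≤-trans (m≤m+n _ (2 * 8 ^ suc ℓ)) (m≤m+n _ (suc ℓ))) large

      cond₁ : 8 * K * 24 ^ n ≤ 25 ^ n
      cond₁ = ^-eventually-dominates 24 (8 * K) n 192K≤

      -- One comparison serves the next two conditions, as 28 and 21 = 3 * 7 both exceed 9.
      cond₂₃ : 6 * K * 8 ^ p ≤ 9 ^ p
      cond₂₃ = ^-eventually-dominates 8 (6 * K) p (≤-trans (≤-trans (m≤m+n _ (144 * K)) (≤-reflexive (lem K))) (m≤n⇒m≤1+n 192K≤))
        where
        lem : ∀ K → 6 * K * 8 + 144 * K ≡ 8 * K * 24
        lem = solve-∀

      cond₂ : 4 * K * 8 ^ p ≤ 28 ^ p
      cond₂ = ≤-trans (*-monoˡ-≤ (8 ^ p) (*-monoˡ-≤ K (m≤m+n 4 2))) (≤-trans cond₂₃ (^-monoˡ-≤ p (m≤m+n 9 19)))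

      cond₃ : 2 * K * 8 ^ p ≤ 3 ^ n * 7 ^ p
      cond₃ = *-cancelˡ-≤ 3 (begin
        3 * (2 * K * 8 ^ p)    ≡⟨ lem K (8 ^ p) ⟩
        6 * K * 8 ^ p          ≤⟨ ≤-trans cond₂₃ (^-monoˡ-≤ p (m≤m+n 9 12)) ⟩
        21 ^ p                 ≡⟨ ^-distribʳ-* 3 7 p ⟩
        3 * 3 ^ n * 7 ^ p      ≡⟨ *-assoc 3 (3 ^ n) (7 ^ p) ⟩
        3 * (3 ^ n * 7 ^ p)    ∎)
        where
        lem : ∀ K e → 3 * (2 * K * e) ≡ 6 * K * e
        lem = solve-∀

      cond₄ : 2 * 8 ^ suc ℓ ≤ 3 ^ p
      cond₄ = begin
        2 * 8 ^ suc ℓ             ≡⟨ *-identityʳ _ ⟨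
        2 * 8 ^ suc ℓ * 1         ≡⟨ cong (2 * 8 ^ suc ℓ *_) (^-zeroˡ p) ⟨
        2 * 8 ^ suc ℓ * 1 ^ p     ≤⟨ ^-eventually-dominates 1 (2 * 8 ^ suc ℓ) p (≤-trans (≤-reflexive (*-identityʳ _))
                                       (m≤n⇒m≤1+n (≤-trans (≤-trans (m≤n+m _ (8 * K * 24)) (m≤m+n _ (suc ℓ))) large))) ⟩
        2 ^ p                     ≤⟨ ^-monoˡ-≤ p (m≤m+n 2 1) ⟩
        3 ^ p                     ∎

      sℓ≤p : suc ℓ ≤ p
      sℓ≤p = m≤n⇒m≤1+n (≤-trans (m≤n+m (suc ℓ) _) large)

    E₁ E₂ : ℕ
    E₁ = 2 * D ^ s
    E₂ = 2 ^ s * (2 * (4 ^ p * (4 * K * 8 ^ p)))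

    beaten-part : ∀ as x bs → 0 < sum (as ++ x ∷ bs) → 3 * sum (as ++ x ∷ bs) ≤ 4 * x →
                  7 ^ p * sum (as ++ x ∷ bs) ^ s ≤ K * 8 ^ p * P (as ++ x ∷ bs) →
                  ∃₂ λ w cs → bs ≡ w ∷ cs × P (as ++ x ∷ bs) ≤ P (sum as + x ∷ bs) ×
                    Beaten ps E₂ (w ^ s) (as ++ x ∷ bs)
    beaten-part as x bs N>0 big h = case bs refl
      where
      N = sum (as ++ x ∷ bs)
      y = sum as
      N≡ : N ≡ y + (x + sum bs)
      N≡ = sum-++ as (x ∷ bs)
      4u≤N : ∀ u → u + x ≤ N → 4 * u ≤ N
      4u≤N u u+x≤N = +-cancelʳ-≤ (4 * x) (4 * u) N (begin
        4 * u + 4 * x  ≡⟨ *-distribˡ-+ 4 u x ⟨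
        4 * (u + x)    ≤⟨ *-monoʳ-≤ 4 u+x≤N ⟩
        N + 3 * N      ≤⟨ +-monoʳ-≤ N big ⟩
        N + 4 * x      ∎)
      x≤N : x ≤ N
      x≤N = ≤-trans (≤-trans (m≤m+n x (sum bs)) (m≤n+m _ y)) (≤-reflexive (sym N≡))
      bs+x≤N : sum bs + x ≤ N
      bs+x≤N = ≤-trans (≤-reflexive (+-comm (sum bs) x)) (≤-trans (m≤n+m _ y) (≤-reflexive (sym N≡)))
      bs≤N : sum bs ≤ N
      bs≤N = m+n≤o⇒m≤o (sum bs) bs+x≤N
      y+x≤N : y + x ≤ N
      y+x≤N = ≤-trans (+-monoʳ-≤ y (m≤m+n x (sum bs))) (≤-reflexive (sym N≡))
      4z≤N = 4u≤N (sum bs) bs+x≤N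
      P≤ : P (as ++ x ∷ bs) ≤ y ^ p * N ^ m + (x ^ p * R bs + P bs)
      P≤ = W-++ pos₁ n as (x ∷ bs) ≤-refl
      P-bs≤ : P bs ≤ sum bs ^ p * N ^ m
      P-bs≤ = ≤-trans (W-peel n ps₁ bs) (*-monoʳ-≤ (sum bs ^ p) (W-bound-≤ pos₁ bs bs≤N))
      module M = Merge x y (sum bs) N (P (as ++ x ∷ bs)) (R bs) N>0 x≤N (4u≤N y y+x≤N) 4z≤N big h
                   (≤-trans P≤ (+-monoʳ-≤ (y ^ p * N ^ m) (+-monoʳ-≤ (x ^ p * R bs) P-bs≤)))
      tail : 7 ^ p * N ^ m ≤ 2 * K * 8 ^ p * R bs
      tail = M.tail-bound cond₂
      merged : P (as ++ x ∷ bs) ≤ P (y + x ∷ bs)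
      merged = begin
        P (as ++ x ∷ bs)                          ≤⟨ P≤ ⟩
        y ^ p * N ^ m + (x ^ p * R bs + P bs)     ≡⟨ +-assoc (y ^ p * N ^ m) _ _ ⟨
        y ^ p * N ^ m + x ^ p * R bs + P bs       ≤⟨ +-monoˡ-≤ (P bs) (M.merge-gain tail cond₃) ⟩
        P (y + x ∷ bs)                            ∎
      case : ∀ bs′ → bs′ ≡ bs → ∃₂ λ w cs → bs ≡ w ∷ cs × P (as ++ x ∷ bs) ≤ P (sum as + x ∷ bs) ×
                    Beaten ps E₂ (w ^ s) (as ++ x ∷ bs)
      -- With nothing after the large part the pattern could not be completed: `R` would vanish,
      -- against the tail bound. Hence there is a layer `w` to halve.
      case [] eq = contradiction
        (≤-trans tail (≤-reflexive (trans (cong (λ z → 2 * K * 8 ^ p * R z) (sym eq)) (*-zeroʳ (2 * K * 8 ^ p)))))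
        (<⇒≱ (*-pos (^-pos {7} p (s≤s z≤n)) (^-pos m N>0)))
      case (w ∷ cs) refl = w , cs , refl , merged , Sp.halved , 2 , z<s ,
        trans Sp.sum-halved (cong (2 *_) (trans (+-assoc y x (w + sum cs)) (sym N≡))) ,
        Sp.split-gain tail cond₄ merged
        where
        module Sp = Split (y + x) w N (p ∸ suc ℓ) cs (m+n≤o⇒n≤o w bs≤N)
                     (≤-trans (*-monoʳ-≤ 4 (m≤m+n w (sum cs))) 4z≤N)
                     (≤-trans big (*-monoʳ-≤ 4 (m≤n+m x y))) N>0 (sym (m+[n∸m]≡n sℓ≤p))

    E₁>0 : 0 < E₁
    E₁>0 = *-pos {2} z<s (^-pos s (s≤s z≤n))

    E₂>0 : 0 < E₂
    E₂>0 = *-pos (^-pos {2} s (s≤s z≤n)) (*-pos {2} z<s (*-pos (^-pos {4} p (s≤s z≤n))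
             (*-pos (*-pos {4} z<s K>0) (^-pos {8} p (s≤s z≤n)))))

    sparse-improvable : ∀ xs → 0 < sum xs → 2 * D ^ s * P xs ≤ (7 * r) ^ p * sum xs ^ s → ImprovableAt ps E₁ xs
    sparse-improvable []       ()
    -- The reference configuration gains on the scale of the total mass, so any part may play the
    -- role of `x`.
    sparse-improvable (x ∷ xs) N>0 le = [] , x , xs , ≤-refl , refl , ≤-refl , reference-beats x xs N>0 le

    large-part-improvable : ∀ {xs} as x bs → xs ≡ as ++ x ∷ bs → 0 < sum xs → 3 * sum xs ≤ 4 * x →
                            7 ^ p * sum xs ^ s ≤ K * 8 ^ p * P xs → ImprovableAt ps E₂ xs
    large-part-improvable as x bs refl N>0 big h = conclude bs (beaten-part as x bs N>0 big h)
      where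
      conclude : ∀ bs → (∃₂ λ w cs → bs ≡ w ∷ cs × P (as ++ x ∷ bs) ≤ P (sum as + x ∷ bs) ×
                    Beaten ps E₂ (w ^ s) (as ++ x ∷ bs)) → ImprovableAt ps E₂ (as ++ x ∷ bs)
      conclude _ (w , cs , refl , merged , beaten) = sum as + x ∷ [] , w , cs ,
        ≤-trans (m≤n+m _ (length as)) (≤-reflexive (sym (length-++ as))) ,
        trans (+-assoc (sum as) x _) (sym (sum-++ as (x ∷ w ∷ cs))) , merged , beaten

    dense-improvable : ∀ xs → 0 < sum xs → 7 ^ p * sum xs ^ s ≤ K * 8 ^ p * P xs → ImprovableAt ps E₂ xs
    dense-improvable xs N>0 h = conclude (large-part? (sum xs) xs)
      where
      conclude : All (λ x → 4 * x ≤ 3 * sum xs) xs ⊎ (∃₂ λ as x → ∃ λ bs → xs ≡ as ++ x ∷ bs × 3 * sum xs ≤ 4 * x) →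
                 ImprovableAt ps E₂ xs
      conclude (inj₁ small)                   = contradiction small (¬small-parts cond₁ xs N>0 h)
      conclude (inj₂ (as , x , bs , eq , big)) = large-part-improvable as x bs eq N>0 big h

    improvable-n-1-ℓ : ∃ λ E → 0 < E × Improvable ps E
    improvable-n-1-ℓ = E₂ * E₁ , *-pos E₂>0 E₁>0 , λ xs N>0 → conclude xs N>0 (≤-total (2 * D ^ s * P xs) ((7 * r) ^ p * sum xs ^ s))
      where
      conclude : ∀ xs → 0 < sum xs → 2 * D ^ s * P xs ≤ (7 * r) ^ p * sum xs ^ s ⊎ (7 * r) ^ p * sum xs ^ s ≤ 2 * D ^ s * P xs →
                 ImprovableAt ps (E₂ * E₁) xs
      conclude xs N>0 (inj₁ le) = ImprovableAt-weaken ps E₁ E₂ xs E₂>0 (sparse-improvable xs N>0 le)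
      conclude xs N>0 (inj₂ ge) = subst (λ E → ImprovableAt ps E xs) (*-comm E₁ E₂)
        (ImprovableAt-weaken ps E₂ E₁ xs E₁>0 (dense-improvable xs N>0 (reference-bound (sum xs) (P xs) ge)))

-- Occurrences in layered permutations

layerCount : List ℕ → List ℕ → ℕ
layerCount []       xs       = 1
layerCount (p ∷ ps) []       = 0
layerCount (p ∷ ps) (x ∷ xs) = (x C p) * layerCount ps xs + layerCount (p ∷ ps) xs

cnt : {A : Set} → (A → Bool) → List A → ℕ
cnt f xs = length (filterᵇ f xs)

cnt-++ : {A : Set} (f : A → Bool) (xs ys : List A) → cnt f (xs ++ ys) ≡ cnt f xs + cnt f ys
cnt-++ f []       ys = refl
cnt-++ f (x ∷ xs) ys with f x
... | true  = cong suc (cnt-++ f xs ys)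
... | false = cnt-++ f xs ys

cnt-map : {A B : Set} (f : B → Bool) (g : A → B) (xs : List A) → cnt f (map g xs) ≡ cnt (f ∘ g) xs
cnt-map f g []       = refl
cnt-map f g (x ∷ xs) with f (g x)
... | true  = cong suc (cnt-map f g xs)
... | false = cnt-map f g xs

cnt-cong : {A : Set} {f g : A → Bool} {xs : List A} → All (λ x → f x ≡ g x) xs → cnt f xs ≡ cnt g xs
cnt-cong []                  = refl
cnt-cong {f = f} {g} {x ∷ xs} (fx≡gx ∷ eqs) with f x | g x | fx≡gx
... | true  | .true  | refl = cong suc (cnt-cong eqs)
... | false | .false | refl = cnt-cong eqs

cnt-false : {A : Set} (xs : List A) → cnt (λ _ → false) xs ≡ 0
cnt-false []       = refl
cnt-false (x ∷ xs) = cnt-false xs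

module _ {A : Set} where

  choose-All : {P : A → Set} → ∀ k {xs} → All P xs → All (λ v → ∀ i → P (lookup v i)) (choose k xs)
  choose-All zero    ps       = (λ ()) ∷ []
  choose-All (suc k) []       = []
  choose-All {P} (suc k) (p ∷ ps) = All.++⁺ (All.map⁺ (All.map cons (choose-All k ps))) (choose-All (suc k) ps)
    where
    cons : ∀ {v} → (∀ i → P (lookup v i)) → ∀ i → P (lookup (_ ∷ v) i)
    cons q zero    = p
    cons q (suc i) = q i

  choose-AllPairs : {R : A → A → Set} → ∀ k {xs} → AllPairs R xs →
                    All (λ v → ∀ i j → i Fin.< j → R (lookup v i) (lookup v j)) (choose k xs)
  choose-AllPairs zero    rs       = (λ ()) ∷ []
  choose-AllPairs (suc k) []       = []
  choose-AllPairs {R} (suc k) {x ∷ xs} (r ∷ rs) =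
    All.++⁺ (All.map⁺ (All.zipWith cons (choose-All k r , choose-AllPairs k rs))) (choose-AllPairs (suc k) rs)
    where
    cons : ∀ {v} → (∀ i → R x (lookup v i)) × (∀ i j → i Fin.< j → R (lookup v i) (lookup v j)) →
           ∀ i j → i Fin.< j → R (lookup (x ∷ v) i) (lookup (x ∷ v) j)
    cons (q , qs) zero    (suc j) _         = q j
    cons (q , qs) (suc i) (suc j) (s<s i<j) = qs i j i<j

choose-map : {A B : Set} (f : A → B) → ∀ k xs → choose k (map f xs) ≡ map (Vec.map f) (choose k xs)
choose-map f zero    xs       = refl
choose-map f (suc k) []       = refl
choose-map f (suc k) (x ∷ xs) =
  trans (cong₂ (λ vs ws → map (f x ∷_) vs ++ ws) (choose-map f k xs) (choose-map f (suc k) xs))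
  (trans (cong (_++ map (Vec.map f) (choose (suc k) xs)) (trans (sym (map-∘ (choose k xs))) (map-∘ (choose k xs))))
  (sym (map-++ (Vec.map f) (map (x ∷_) (choose k xs)) (choose (suc k) xs))))

-- p copies of c, then one block of consecutive larger labels per entry of ps.
blockLabels : ℕ → (p : ℕ) (ps : List ℕ) → Vec ℕ (p + sum ps)
blockLabels c zero    []       = []
blockLabels c zero    (p ∷ ps) = blockLabels (suc c) p ps
blockLabels c (suc p) ps       = c ∷ blockLabels c p ps

-- Only consecutive entries are compared, `a` and `b` being the labels just before; this makes the
-- count recursive along `choose`.
ascentsAgree : {k : ℕ} → ℕ → ℕ → Vec ℕ k → Vec ℕ k → Bool
ascentsAgree a b []       []       = true
ascentsAgree a b (t ∷ ts) (u ∷ us) = not ((a <ᵇ t) xor (b <ᵇ u)) ∧ ascentsAgree t u ts us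

<⇒<ᵇ≡true : ∀ {m n} → m < n → (m <ᵇ n) ≡ true
<⇒<ᵇ≡true {zero}  z<s       = refl
<⇒<ᵇ≡true {suc m} (s<s m<n) = <⇒<ᵇ≡true m<n

≥⇒<ᵇ≡false : ∀ {m n} → n ≤ m → (m <ᵇ n) ≡ false
≥⇒<ᵇ≡false {m}     z≤n       = refl
≥⇒<ᵇ≡false {suc m} (s≤s n≤m) = ≥⇒<ᵇ≡false n≤m

cnt-choose-∷ : {A : Set} → ∀ k (f : Vec A (suc k) → Bool) x xs →
               cnt f (choose (suc k) (x ∷ xs)) ≡ cnt (f ∘ (x ∷_)) (choose k xs) + cnt f (choose (suc k) xs)
cnt-choose-∷ k f x xs = trans (cnt-++ f (map (x ∷_) (choose k xs)) _) (cong (_+ cnt f (choose (suc k) xs)) (cnt-map f (x ∷_) (choose k xs)))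

module _ {k : ℕ} (a b t x : ℕ) (ts : Vec ℕ k) (xs : List ℕ) where

  private
    heads : cnt (ascentsAgree a b (t ∷ ts)) (choose (suc k) (x ∷ xs)) ≡
            cnt (λ us → not ((a <ᵇ t) xor (b <ᵇ x)) ∧ ascentsAgree t x ts us) (choose k xs) + cnt (ascentsAgree a b (t ∷ ts)) (choose (suc k) xs)
    heads = cnt-choose-∷ k (ascentsAgree a b (t ∷ ts)) x xs

  cnt-agree : (a <ᵇ t) ≡ (b <ᵇ x) → cnt (ascentsAgree a b (t ∷ ts)) (choose (suc k) (x ∷ xs)) ≡
              cnt (ascentsAgree t x ts) (choose k xs) + cnt (ascentsAgree a b (t ∷ ts)) (choose (suc k) xs)
  cnt-agree eq = trans heads (cong (_+ cnt (ascentsAgree a b (t ∷ ts)) (choose (suc k) xs))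
    (cnt-cong {xs = choose k xs} (All.universal (λ us → cong (_∧ ascentsAgree t x ts us) agree) _)))
    where
    xor-refl : ∀ b → not (b xor b) ≡ true
    xor-refl true  = refl
    xor-refl false = refl
    agree : not ((a <ᵇ t) xor (b <ᵇ x)) ≡ true
    agree = trans (cong (λ z → not (z xor (b <ᵇ x))) eq) (xor-refl (b <ᵇ x))

  cnt-disagree : (a <ᵇ t) ≡ not (b <ᵇ x) → cnt (ascentsAgree a b (t ∷ ts)) (choose (suc k) (x ∷ xs)) ≡
                 cnt (ascentsAgree a b (t ∷ ts)) (choose (suc k) xs)
  cnt-disagree eq = trans heads (cong (_+ cnt (ascentsAgree a b (t ∷ ts)) (choose (suc k) xs))
    (trans (cnt-cong {xs = choose k xs} (All.universal (λ us → cong (_∧ ascentsAgree t x ts us) disagree) _)) (cnt-false (choose k xs))))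
    where
    xor-not : ∀ b → not (not b xor b) ≡ false
    xor-not true  = refl
    xor-not false = refl
    disagree : not ((a <ᵇ t) xor (b <ᵇ x)) ≡ false
    disagree = trans (cong (λ z → not (z xor (b <ᵇ x))) eq) (xor-not (b <ᵇ x))

n<ᵇn≡false : ∀ n → (n <ᵇ n) ≡ false
n<ᵇn≡false n = ≥⇒<ᵇ≡false (≤-refl {n})

-- The pattern asks for another point of the current block, while only strictly larger labels are
-- left in the host.
count-broken-block : ∀ {k} (ts : Vec ℕ k) c u v x xs → u < v →
                     cnt (ascentsAgree c u (c ∷ ts)) (choose (suc k) (toList (blockLabels v x xs))) ≡ 0
count-broken-block ts c u v zero    []       u<v = refl
count-broken-block ts c u v zero    (x ∷ xs) u<v = count-broken-block ts c u (suc v) x xs (m<n⇒m<1+n u<v)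
count-broken-block ts c u v (suc x) xs       u<v =
  trans (cnt-disagree c u c v ts (toList (blockLabels v x xs)) (trans (n<ᵇn≡false c) (cong not (sym (<⇒<ᵇ≡true u<v)))))
        (count-broken-block ts c u v x xs u<v)

pascal : ∀ x p a b → (x C p) * a + ((x C suc p) * a + b) ≡ (suc x C suc p) * a + b
pascal x p a b = trans (lem (x C p) (x C suc p) a b) (cong (λ z → z * a + b) (nCk+nC[k+1]≡[n+1]C[k+1] x p))
  where
  lem : ∀ y z a b → y * a + (z * a + b) ≡ (y + z) * a + b
  lem = solve-∀

mutual

  -- State of a left-to-right scan in which a pattern block is about to begin. The next host point
  -- is either its first point or skipped, and Pascal's rule adds the two counts.
  count-new-block : ∀ {ps} → All (1 ≤_) ps → ∀ {a b} c u p x xs → a < c → b < u →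
                    cnt (ascentsAgree a b (blockLabels c (suc p) ps)) (choose (suc p + sum ps) (toList (blockLabels u x xs)))
                      ≡ layerCount (suc p ∷ ps) (x ∷ xs)
  count-new-block pos c u p zero []       a<c b<u = refl
  count-new-block pos c u p zero (x ∷ xs) a<c b<u = count-new-block pos c (suc u) p x xs a<c (m<n⇒m<1+n b<u)
  count-new-block {ps} pos {a} {b} c u p (suc x) xs a<c b<u =
    trans (cnt-agree a b c u (blockLabels c p ps) (toList (blockLabels u x xs)) (trans (<⇒<ᵇ≡true a<c) (sym (<⇒<ᵇ≡true b<u))))
    (trans (cong₂ _+_ (count-same-block pos c u p x xs) (count-new-block pos c u p x xs a<c b<u))
           (pascal x p (layerCount ps xs) (layerCount (suc p ∷ ps) xs)))

  -- State of the scan inside a block: `p` more points are wanted from the `x` left in the host's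
  -- block. Once `p` is zero those left over must be skipped, since the next pattern block demands
  -- an ascent.
  count-same-block : ∀ {ps} → All (1 ≤_) ps → ∀ c u p x xs →
                     cnt (ascentsAgree c u (blockLabels c p ps)) (choose (p + sum ps) (toList (blockLabels u x xs)))
                       ≡ (x C p) * layerCount ps xs
  count-same-block []                     c u zero    x       xs = refl
  count-same-block {suc q ∷ ps} (_ ∷ pos) c u zero    zero    []       = refl
  count-same-block {suc q ∷ ps} (_ ∷ pos) c u zero    zero    (x ∷ xs) =
    trans (count-new-block pos (suc c) (suc u) q x xs ≤-refl ≤-refl) (sym (+-identityʳ _))
  count-same-block {suc q ∷ ps} (q≥1 ∷ pos) c u zero    (suc x) xs =
    trans (cnt-disagree c u (suc c) u (blockLabels (suc c) q ps) (toList (blockLabels u x xs))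
             (trans (<⇒<ᵇ≡true (≤-refl {suc c})) (cong not (sym (n<ᵇn≡false u)))))
          (count-same-block (q≥1 ∷ pos) c u zero x xs)
  count-same-block pos c u (suc p) zero    []       = refl
  count-same-block {ps} pos c u (suc p) zero    (x ∷ xs) = count-broken-block (blockLabels c p ps) c u (suc u) x xs ≤-refl
  count-same-block {ps} pos c u (suc p) (suc x) xs =
    trans (cnt-agree c u c u (blockLabels c p ps) (toList (blockLabels u x xs)) (trans (n<ᵇn≡false c) (sym (n<ᵇn≡false u))))
    (trans (cong₂ _+_ (count-same-block pos c u p x xs) (count-same-block pos c u (suc p) x xs))
    (trans (cong ((x C p) * layerCount ps xs +_) (sym (+-identityʳ _)))
    (trans (pascal x p (layerCount ps xs) 0) (+-identityʳ _))))

-- Layers and values of a layered permutation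

layerOf : List ℕ → ℕ → ℕ
layerOf []       i = 0
layerOf (s ∷ ls) i = if i <ᵇ s then 0 else suc (layerOf ls (i ∸ s))

lookup-blockLabels : ∀ c p ps i → lookup (blockLabels c p ps) i ≡ c + layerOf (p ∷ ps) (toℕ i)
lookup-blockLabels c zero    (p ∷ ps) i       = trans (lookup-blockLabels (suc c) p ps i) (sym (+-suc c _))
lookup-blockLabels c (suc p) ps       zero    = sym (+-identityʳ c)
lookup-blockLabels c (suc p) ps       (suc i) = lookup-blockLabels c p ps i

data Position (s : ℕ) : ℕ → Set where
  inside : ∀ {i} → i < s → Position s i
  beyond : ∀ j → Position s (s + j)

position : ∀ s i → Position s i
position s i with i <? s
... | yes i<s = inside i<s
... | no  i≮s = subst (Position s) (m+[n∸m]≡n (≮⇒≥ i≮s)) (beyond (i ∸ s))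

if-true : {A : Set} {b : Bool} {x y : A} → b ≡ true → (if b then x else y) ≡ x
if-true refl = refl

if-false : {A : Set} {b : Bool} {x y : A} → b ≡ false → (if b then x else y) ≡ y
if-false refl = refl

module _ (s : ℕ) (ls : List ℕ) where

  layerOf-inside : ∀ {i} → i < s → layerOf (s ∷ ls) i ≡ 0
  layerOf-inside i<s = if-true (<⇒<ᵇ≡true i<s)

  layerOf-beyond : ∀ j → layerOf (s ∷ ls) (s + j) ≡ suc (layerOf ls j)
  layerOf-beyond j = trans (if-false (≥⇒<ᵇ≡false (m≤m+n s j))) (cong (suc ∘ layerOf ls) (m+n∸m≡n s j))

  layeredVal-inside : ∀ {i} → i < s → layeredVal (s ∷ ls) i ≡ s ∸ suc i
  layeredVal-inside {i} i<s = trans (if-true (<⇒<ᵇ≡true i<s)) (∸-+-assoc s 1 i)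

  layeredVal-beyond : ∀ j → layeredVal (s ∷ ls) (s + j) ≡ s + layeredVal ls j
  layeredVal-beyond j = trans (if-false (≥⇒<ᵇ≡false (m≤m+n s j))) (cong (λ z → s + layeredVal ls z) (m+n∸m≡n s j))

∸-suc-< : ∀ {s i} → i < s → s ∸ suc i < s
∸-suc-< {s} {i} i<s = ∸-monoʳ-< {s} {suc i} {0} z<s i<s

layeredVal-< : ∀ ls {i} → i < sum ls → layeredVal ls i < sum ls
layeredVal-< (s ∷ ls) {i} i<sum with position s i
... | inside i<s rewrite layeredVal-inside s ls i<s = ≤-trans (∸-suc-< i<s) (m≤m+n s (sum ls))
... | beyond j   rewrite layeredVal-beyond s ls j   = +-monoʳ-< s (layeredVal-< ls (+-cancelˡ-< s j (sum ls) i<sum))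

layeredVal-involutive : ∀ ls i → layeredVal ls (layeredVal ls i) ≡ i
layeredVal-involutive []       i = refl
layeredVal-involutive (s ∷ ls) i with position s i
... | inside i<s rewrite layeredVal-inside s ls i<s | layeredVal-inside s ls (∸-suc-< i<s) = begin-equality
  s ∸ suc (s ∸ suc i)  ≡⟨ cong (s ∸_) (sym (+-∸-assoc 1 i<s)) ⟩
  s ∸ (s ∸ i)          ≡⟨ m∸[m∸n]≡n (<⇒≤ i<s) ⟩
  i                    ∎
... | beyond j rewrite layeredVal-beyond s ls j | layeredVal-beyond s ls (layeredVal ls j) =
  cong (s +_) (layeredVal-involutive ls j)

layered-pair : ∀ ls {i j} → i < j → j < sum ls →
               (layerOf ls i ≡ layerOf ls j × layeredVal ls j < layeredVal ls i) ⊎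
               (layerOf ls i < layerOf ls j × layeredVal ls i < layeredVal ls j)
layered-pair (s ∷ ls) {i} {j} i<j j<sum with position s i | position s j
... | inside i<s | inside j<s
  rewrite layerOf-inside s ls i<s | layerOf-inside s ls j<s | layeredVal-inside s ls i<s | layeredVal-inside s ls j<s
  = inj₁ (refl , ∸-monoʳ-< (s<s i<j) j<s)
... | inside i<s | beyond j′
  rewrite layerOf-inside s ls i<s | layerOf-beyond s ls j′ | layeredVal-inside s ls i<s | layeredVal-beyond s ls j′
  = inj₂ (z<s , ≤-trans (∸-suc-< i<s) (m≤m+n s _))
... | beyond i′ | inside j<s = contradiction (<-trans i<j j<s) (≤⇒≯ (m≤m+n s i′))
... | beyond i′ | beyond j′
  rewrite layerOf-beyond s ls i′ | layerOf-beyond s ls j′ | layeredVal-beyond s ls i′ | layeredVal-beyond s ls j′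
  with layered-pair ls (+-cancelˡ-< s i′ j′ i<j) (+-cancelˡ-< s j′ (sum ls) j<sum)
... | inj₁ (same , desc) = inj₁ (cong suc same , +-monoʳ-< s desc)
... | inj₂ (next , asc)  = inj₂ (s<s next , +-monoʳ-< s asc)

module _ (ls : List ℕ) {i j : ℕ} (i<j : i < j) (j<sum : j < sum ls) where

  layerOf-mono : layerOf ls i ≤ layerOf ls j
  layerOf-mono with layered-pair ls i<j j<sum
  ... | inj₁ (same , _) = ≤-reflexive same
  ... | inj₂ (next , _) = <⇒≤ next

  ascent : (layeredVal ls i <ᵇ layeredVal ls j) ≡ (layerOf ls i <ᵇ layerOf ls j)
  ascent with layered-pair ls i<j j<sum
  ... | inj₁ (same , desc) = trans (≥⇒<ᵇ≡false (<⇒≤ desc)) (sym (≥⇒<ᵇ≡false (≤-reflexive (sym same))))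
  ... | inj₂ (next , asc)  = trans (<⇒<ᵇ≡true asc) (sym (<⇒<ᵇ≡true next))

  descent : (layeredVal ls j <ᵇ layeredVal ls i) ≡ not (layerOf ls i <ᵇ layerOf ls j)
  descent with layered-pair ls i<j j<sum
  ... | inj₁ (same , desc) = trans (<⇒<ᵇ≡true desc) (cong not (sym (≥⇒<ᵇ≡false (≤-reflexive (sym same)))))
  ... | inj₂ (next , asc)  = trans (≥⇒<ᵇ≡false (<⇒≤ asc)) (cong not (sym (<⇒<ᵇ≡true next)))

-- Agreement of consecutive ascents and induced patterns

-- Transitive, so that on weakly increasing sequences agreement of the
-- consecutive ascents propagates to all pairs of positions.
Together : ℕ × ℕ → ℕ × ℕ → Set
Together (a , b) (c , d) = (a ≡ c × b ≡ d) ⊎ (a < c × b < d)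

Together-trans : ∀ {x y z} → Together x y → Together y z → Together x z
Together-trans (inj₁ (refl , refl)) h                    = h
Together-trans (inj₂ h)             (inj₁ (refl , refl)) = inj₂ h
Together-trans (inj₂ (p , q))       (inj₂ (r , s))       = inj₂ (<-trans p r , <-trans q s)

Together⇒<ᵇ : ∀ {a b c d} → Together (a , b) (c , d) → (a <ᵇ c) ≡ (b <ᵇ d)
Together⇒<ᵇ {a} {b} (inj₁ (refl , refl)) = trans (n<ᵇn≡false a) (sym (n<ᵇn≡false b))
Together⇒<ᵇ         (inj₂ (p , q))       = trans (<⇒<ᵇ≡true p) (sym (<⇒<ᵇ≡true q))

∧-splits : ∀ x {y} → x ∧ y ≡ true → x ≡ true × y ≡ true
∧-splits true  h = refl , h

not-xor⇒≡ : ∀ x y → not (x xor y) ≡ true → x ≡ y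
not-xor⇒≡ true  true  _ = refl
not-xor⇒≡ false false _ = refl

≡⇒not-xor : ∀ x {y} → x ≡ y → not (x xor y) ≡ true
≡⇒not-xor true  refl = refl
≡⇒not-xor false refl = refl

≤∧≮ᵇ⇒≡ : ∀ {a b} → a ≤ b → (a <ᵇ b) ≡ false → a ≡ b
≤∧≮ᵇ⇒≡ {a} {b} a≤b a≮b with m≤n⇒m<n∨m≡n a≤b
... | inj₂ a≡b = a≡b
... | inj₁ a<b = contradiction (trans (sym (<⇒<ᵇ≡true a<b)) a≮b) λ ()

<ᵇ≡⇒Together : ∀ {a b c d} → a ≤ c → b ≤ d → (a <ᵇ c) ≡ (b <ᵇ d) → Together (a , b) (c , d)
<ᵇ≡⇒Together {a} {b} {c} {d} a≤c b≤d eq with a <ᵇ c in e₁ | b <ᵇ d in e₂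
... | true  | true  = inj₂ (<ᵇ⇒< a c (subst Bool.T (sym e₁) _) , <ᵇ⇒< b d (subst Bool.T (sym e₂) _))
... | false | false = inj₁ (≤∧≮ᵇ⇒≡ a≤c e₁ , ≤∧≮ᵇ⇒≡ b≤d e₂)
... | true  | false = contradiction eq λ ()
... | false | true  = contradiction eq λ ()

Sorted : ∀ {k} → ℕ → Vec ℕ k → Set
Sorted a ts = (∀ i → a ≤ lookup ts i) × (∀ i j → i Fin.< j → lookup ts i ≤ lookup ts j)

Sorted-tail : ∀ {k a t} {ts : Vec ℕ k} → Sorted a (t ∷ ts) → Sorted t ts
Sorted-tail (_ , h) = (λ i → h zero (suc i) z<s) , (λ i j i<j → h (suc i) (suc j) (s<s i<j))

ascentsAgree⇒Together : ∀ {k a b} (ts us : Vec ℕ k) → Sorted a ts → Sorted b us → ascentsAgree a b ts us ≡ true →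
  (∀ i → Together (a , b) (lookup ts i , lookup us i)) ×
  (∀ i j → i Fin.< j → Together (lookup ts i , lookup us i) (lookup ts j , lookup us j))
ascentsAgree⇒Together []       []       st su agree = (λ ()) , (λ ())
ascentsAgree⇒Together {a = a} {b} (t ∷ ts) (u ∷ us) st su agree
  with ∧-splits (not ((a <ᵇ t) xor (b <ᵇ u))) agree
... | headAgrees , tailAgrees
  with ascentsAgree⇒Together ts us (Sorted-tail {ts = ts} st) (Sorted-tail {ts = us} su) tailAgrees
... | fromHead , pairs = from , both
  where
  step : Together (a , b) (t , u)
  step = <ᵇ≡⇒Together (proj₁ st zero) (proj₁ su zero) (not-xor⇒≡ (a <ᵇ t) (b <ᵇ u) headAgrees)
  from : ∀ i → Together (a , b) (lookup (t ∷ ts) i , lookup (u ∷ us) i)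
  from zero    = step
  from (suc i) = Together-trans step (fromHead i)
  both : ∀ i j → i Fin.< j → Together (lookup (t ∷ ts) i , lookup (u ∷ us) i) (lookup (t ∷ ts) j , lookup (u ∷ us) j)
  both zero    (suc j) _         = fromHead j
  both (suc i) (suc j) (s<s i<j) = pairs i j i<j

pairsAgree⇒ascentsAgree : ∀ {k a b} (ts us : Vec ℕ k) → (∀ i → (a <ᵇ lookup ts i) ≡ (b <ᵇ lookup us i)) →
  (∀ i j → i Fin.< j → (lookup ts i <ᵇ lookup ts j) ≡ (lookup us i <ᵇ lookup us j)) → ascentsAgree a b ts us ≡ true
pairsAgree⇒ascentsAgree []       []       fromHead pairs = refl
pairsAgree⇒ascentsAgree {a = a} (t ∷ ts) (u ∷ us) fromHead pairs =
  cong₂ _∧_ (≡⇒not-xor (a <ᵇ t) (fromHead zero))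
    (pairsAgree⇒ascentsAgree ts us (λ i → pairs zero (suc i) z<s) (λ i j i<j → pairs (suc i) (suc j) (s<s i<j)))

all-tabulate⁺ : ∀ {n} {A : Set} (p : A → Bool) (f : Fin n → A) → (∀ i → p (f i) ≡ true) → all p (tabulate f) ≡ true
all-tabulate⁺ {zero}  p f h = refl
all-tabulate⁺ {suc n} p f h = cong₂ _∧_ (h zero) (all-tabulate⁺ p (f ∘ suc) (h ∘ suc))

all-tabulate⁻ : ∀ {n} {A : Set} (p : A → Bool) (f : Fin n → A) → all p (tabulate f) ≡ true → ∀ i → p (f i) ≡ true
all-tabulate⁻ {suc n} p f h i with ∧-splits (p (f zero)) h
all-tabulate⁻ {suc n} p f h zero    | h₀ , _  = h₀
all-tabulate⁻ {suc n} p f h (suc i) | _  , hs = all-tabulate⁻ p (f ∘ suc) hs i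

≡true-ext : ∀ {x y} → (x ≡ true → y ≡ true) → (y ≡ true → x ≡ true) → x ≡ y
≡true-ext {true}  {true}  f g = refl
≡true-ext {false} {false} f g = refl
≡true-ext {true}  {false} f g = sym (f refl)
≡true-ext {false} {true}  f g = g refl

tabulate-lookup : ∀ {A : Set} {n} (v : Vec A n) → tabulate (lookup v) ≡ toList v
tabulate-lookup []      = refl
tabulate-lookup (x ∷ v) = cong (x ∷_) (tabulate-lookup v)

FollowsLayers : ∀ {n} → Permutation′ n → List ℕ → Set
FollowsLayers π ls = ∀ i → toℕ (π ⟨$⟩ʳ i) ≡ layeredVal ls (toℕ i)

-- Zero copies of the label 1 come first, so genuine blocks start at 2, above the initial value 0
-- from which `ascentsAgree` starts.
labels : (ls : List ℕ) → Vec ℕ (sum ls)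
labels = blockLabels 1 0

module _ (ls : List ℕ) (π : Permutation′ (sum ls)) (π-layers : FollowsLayers π ls) where

  private
    label<ᵇ : ∀ i j → (lookup (labels ls) i <ᵇ lookup (labels ls) j) ≡ (layerOf ls (toℕ i) <ᵇ layerOf ls (toℕ j))
    label<ᵇ i j = cong₂ _<ᵇ_ (lookup-blockLabels 1 0 ls i) (lookup-blockLabels 1 0 ls j)

  value-ascent : ∀ i j → i Fin.< j → (toℕ (π ⟨$⟩ʳ i) <ᵇ toℕ (π ⟨$⟩ʳ j)) ≡ (lookup (labels ls) i <ᵇ lookup (labels ls) j)
  value-ascent i j i<j = trans (cong₂ _<ᵇ_ (π-layers i) (π-layers j))
    (trans (ascent ls i<j (Fin.toℕ<n j)) (sym (label<ᵇ i j)))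

  value-descent : ∀ i j → i Fin.< j → (toℕ (π ⟨$⟩ʳ j) <ᵇ toℕ (π ⟨$⟩ʳ i)) ≡ not (lookup (labels ls) i <ᵇ lookup (labels ls) j)
  value-descent i j i<j = trans (cong₂ _<ᵇ_ (π-layers j) (π-layers i))
    (trans (descent ls i<j (Fin.toℕ<n j)) (cong not (sym (label<ᵇ i j))))

  label-mono : ∀ i j → i Fin.< j → lookup (labels ls) i ≤ lookup (labels ls) j
  label-mono i j i<j = subst₂ _≤_ (sym (lookup-blockLabels 1 0 ls i)) (sym (lookup-blockLabels 1 0 ls j))
    (s≤s (s≤s (layerOf-mono ls i<j (Fin.toℕ<n j))))

  label-pos : ∀ i → 0 < lookup (labels ls) i
  label-pos i = subst (0 <_) (sym (lookup-blockLabels 1 0 ls i)) z<s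

module _ (ps xs : List ℕ) (σ : Permutation′ (sum ps)) (π : Permutation′ (sum xs))
         (σ-layers : FollowsLayers σ ps) (π-layers : FollowsLayers π xs) where

  private
    ts = labels ps
    label = lookup (labels xs)

  -- `induces` compares all ordered pairs of positions. Those in increasing order reduce to
  -- consecutive ones through `Together`; for the reversed ones, the comparison of values is the
  -- negated ascent of labels in both permutations.
  induces≡ascentsAgree : ∀ v → (∀ i j → i Fin.< j → lookup v i Fin.< lookup v j) →
                         induces σ π v ≡ ascentsAgree 0 0 ts (Vec.map label v)
  induces≡ascentsAgree v incr = ≡true-ext to from
    where
    us = Vec.map label v
    us-lookup : ∀ i → lookup us i ≡ label (lookup v i)
    us-lookup i = lookup-map i label v
    agreesAt : Fin (sum ps) → Fin (sum ps) → Bool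
    agreesAt j j′ = not ((toℕ (σ ⟨$⟩ʳ j) <ᵇ toℕ (σ ⟨$⟩ʳ j′)) xor (toℕ (π ⟨$⟩ʳ lookup v j) <ᵇ toℕ (π ⟨$⟩ʳ lookup v j′)))
    us<ᵇ : ∀ i j → (lookup us i <ᵇ lookup us j) ≡ (label (lookup v i) <ᵇ label (lookup v j))
    us<ᵇ i j = cong₂ _<ᵇ_ (us-lookup i) (us-lookup j)
    to : induces σ π v ≡ true → ascentsAgree 0 0 ts us ≡ true
    to h = pairsAgree⇒ascentsAgree ts us
      (λ i → trans (<⇒<ᵇ≡true (label-pos ps σ σ-layers i))
                   (sym (<⇒<ᵇ≡true (subst (0 <_) (sym (us-lookup i)) (label-pos xs π π-layers (lookup v i))))))
      (λ i j i<j → trans (sym (value-ascent ps σ σ-layers i j i<j))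
        (trans (not-xor⇒≡ _ _ (all-tabulate⁻ (agreesAt i) id (all-tabulate⁻ (λ j → all (agreesAt j) (allFin (sum ps))) id h i) j))
        (trans (value-ascent xs π π-layers _ _ (incr i j i<j)) (sym (us<ᵇ i j)))))
    from : ascentsAgree 0 0 ts us ≡ true → induces σ π v ≡ true
    from h = all-tabulate⁺ (λ j → all (agreesAt j) (allFin (sum ps))) id
               (λ i → all-tabulate⁺ (agreesAt i) id (λ j → ≡⇒not-xor _ (agree i j)))
      where
      together : ∀ i j → i Fin.< j → (lookup ts i <ᵇ lookup ts j) ≡ (label (lookup v i) <ᵇ label (lookup v j))
      together i j i<j = trans (Together⇒<ᵇ (proj₂ (ascentsAgree⇒Together ts us
        ((λ _ → z≤n) , label-mono ps σ σ-layers)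
        ((λ _ → z≤n) , λ i j i<j → subst₂ _≤_ (sym (us-lookup i)) (sym (us-lookup j)) (label-mono xs π π-layers _ _ (incr i j i<j)))
        h) i j i<j)) (us<ᵇ i j)
      agree : ∀ i j → (toℕ (σ ⟨$⟩ʳ i) <ᵇ toℕ (σ ⟨$⟩ʳ j)) ≡ (toℕ (π ⟨$⟩ʳ lookup v i) <ᵇ toℕ (π ⟨$⟩ʳ lookup v j))
      agree i j with Fin.<-cmp i j
      ... | tri≈ _ refl _ = trans (n<ᵇn≡false (toℕ (σ ⟨$⟩ʳ i))) (sym (n<ᵇn≡false (toℕ (π ⟨$⟩ʳ lookup v i))))
      ... | tri< i<j _ _  = trans (value-ascent ps σ σ-layers i j i<j)
                           (trans (together i j i<j) (sym (value-ascent xs π π-layers _ _ (incr i j i<j))))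
      ... | tri> _ _ j<i  = trans (value-descent ps σ σ-layers j i j<i)
                           (trans (cong not (together j i j<i)) (sym (value-descent xs π π-layers _ _ (incr j i j<i))))

  occurrences-cnt : occurrences σ π ≡ cnt (ascentsAgree 0 0 ts) (choose (sum ps) (toList (labels xs)))
  occurrences-cnt = begin-equality
    cnt (induces σ π) (choose (sum ps) (allFin (sum xs)))
      ≡⟨ cnt-cong (All.map (λ {v} → induces≡ascentsAgree v) (choose-AllPairs (sum ps) (AllPairs.tabulate⁺-< id))) ⟩
    cnt (ascentsAgree 0 0 ts ∘ Vec.map label) (choose (sum ps) (allFin (sum xs)))
      ≡⟨ cnt-map (ascentsAgree 0 0 ts) (Vec.map label) (choose (sum ps) (allFin (sum xs))) ⟨
    cnt (ascentsAgree 0 0 ts) (map (Vec.map label) (choose (sum ps) (allFin (sum xs))))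
      ≡⟨ cong (cnt (ascentsAgree 0 0 ts)) (choose-map label (sum ps) (allFin (sum xs))) ⟨
    cnt (ascentsAgree 0 0 ts) (choose (sum ps) (map label (allFin (sum xs))))
      ≡⟨ cong (cnt (ascentsAgree 0 0 ts) ∘ choose (sum ps)) (trans (map-tabulate id label) (tabulate-lookup (labels xs))) ⟩
    cnt (ascentsAgree 0 0 ts) (choose (sum ps) (toList (labels xs))) ∎

occurrences-layered : ∀ {ps} xs → All (1 ≤_) ps → (σ : Permutation′ (sum ps)) (π : Permutation′ (sum xs)) →
                      FollowsLayers σ ps → FollowsLayers π xs → occurrences σ π ≡ layerCount ps xs
occurrences-layered {[]}         xs pos       σ π hσ hπ = occurrences-cnt [] xs σ π hσ hπ
occurrences-layered {suc p ∷ ps} xs (_ ∷ pos) σ π hσ hπ =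
  -- The pattern's labels reduce to a first block labelled 2, while the host starts in an empty
  -- block labelled 1, which contributes nothing.
  trans (occurrences-cnt (suc p ∷ ps) xs σ π hσ hπ) (count-new-block pos 2 1 p 0 xs z<s z<s)

layeredPermutation : (ls : List ℕ) → Permutation′ (sum ls)
layeredPermutation ls = permutation flip flip flip-flip flip-flip
  where
  flip : Fin (sum ls) → Fin (sum ls)
  flip i = fromℕ< (layeredVal-< ls (Fin.toℕ<n i))
  flip-flip : ∀ i → flip (flip i) ≡ i
  flip-flip i = Fin.toℕ-injective (begin-equality
    toℕ (flip (flip i))                     ≡⟨ Fin.toℕ-fromℕ< _ ⟩
    layeredVal ls (toℕ (flip i))            ≡⟨ cong (layeredVal ls) (Fin.toℕ-fromℕ< _) ⟩
    layeredVal ls (layeredVal ls (toℕ i))   ≡⟨ layeredVal-involutive ls (toℕ i) ⟩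
    toℕ i                                   ∎)

layeredPermutation-layers : ∀ ls → FollowsLayers (layeredPermutation ls) ls
layeredPermutation-layers ls i = Fin.toℕ-fromℕ< _

-- From binomial coefficients to powers

C-absorb : ∀ n k → suc k * (suc n C suc k) ≡ suc n * (n C k)
C-absorb zero    zero    = refl
C-absorb zero    (suc k) = *-zeroʳ (suc (suc k))
C-absorb (suc n) zero    = trans (+-identityʳ _) (trans (nC1≡n (suc (suc n))) (sym (*-identityʳ _)))
C-absorb (suc n) (suc k) = begin-equality
  suc (suc k) * (suc (suc n) C suc (suc k))
    ≡⟨ cong (suc (suc k) *_) (nCk+nC[k+1]≡[n+1]C[k+1] (suc n) (suc k)) ⟨
  suc (suc k) * ((suc n C suc k) + (suc n C suc (suc k)))
    ≡⟨ lem k (suc n C suc k) (suc n C suc (suc k)) ⟩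
  (suc n C suc k) + (suc k * (suc n C suc k) + suc (suc k) * (suc n C suc (suc k)))
    ≡⟨ cong₂ (λ a b → (suc n C suc k) + (a + b)) (C-absorb n k) (C-absorb n (suc k)) ⟩
  (suc n C suc k) + (suc n * (n C k) + suc n * (n C suc k))
    ≡⟨ cong ((suc n C suc k) +_) (trans (sym (*-distribˡ-+ (suc n) (n C k) (n C suc k))) (cong (suc n *_) (nCk+nC[k+1]≡[n+1]C[k+1] n k))) ⟩
  suc (suc n) * (suc n C suc k) ∎
  where
  lem : ∀ k a b → suc (suc k) * (a + b) ≡ a + (suc k * a + suc (suc k) * b)
  lem = solve-∀

!*C-suc : ∀ n k → suc k ! * (suc n C suc k) ≡ suc n * (k ! * (n C k))
!*C-suc n k = begin-equality
  suc k * k ! * (suc n C suc k)     ≡⟨ lem (suc k) (k !) (suc n C suc k) ⟩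
  k ! * (suc k * (suc n C suc k))   ≡⟨ cong (k ! *_) (C-absorb n k) ⟩
  k ! * (suc n * (n C k))           ≡⟨ lem₁ (k !) (suc n) (n C k) ⟩
  suc n * (k ! * (n C k))           ∎
  where
  lem : ∀ a b c → a * b * c ≡ b * (a * c)
  lem = solve-∀
  lem₁ : ∀ a b c → a * (b * c) ≡ b * (a * c)
  lem₁ = solve-∀

!*C≤^ : ∀ n k → k ! * (n C k) ≤ n ^ k
!*C≤^ n       zero    = ≤-refl
!*C≤^ zero    (suc k) = ≤-reflexive (*-zeroʳ (suc k !))
!*C≤^ (suc n) (suc k) = begin
  suc k ! * (suc n C suc k)   ≡⟨ !*C-suc n k ⟩
  suc n * (k ! * (n C k))     ≤⟨ *-monoʳ-≤ (suc n) (≤-trans (!*C≤^ n k) (^-monoˡ-≤ k (n≤1+n n))) ⟩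
  suc n * suc n ^ k           ∎

^≤!*C : ∀ {x n} k → x + k ≤ n → x ^ k ≤ k ! * (n C k)
^≤!*C             zero    h = ≤-refl
^≤!*C {x} {zero}  (suc k) h = contradiction (≤-trans (m≤n+m (suc k) x) h) λ ()
^≤!*C {x} {suc n} (suc k) h = begin
  x * x ^ k                   ≤⟨ *-mono-≤ (m+n≤o⇒m≤o x h) (^≤!*C k (s≤s⁻¹ (≤-trans (≤-reflexive (sym (+-suc x k))) h))) ⟩
  suc n * (k ! * (n C k))     ≡⟨ !*C-suc n k ⟨
  suc k ! * (suc n C suc k)   ∎

factorials : List ℕ → ℕ
factorials ps = product (map _! ps)

exchange : ∀ a b c d → a * b * (c * d) ≡ a * c * (b * d)
exchange = solve-∀

layerCount≤W : ∀ ps xs → factorials ps * layerCount ps xs ≤ W ps xs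
layerCount≤W []       xs       = ≤-refl
layerCount≤W (p ∷ ps) []       = ≤-reflexive (*-zeroʳ (factorials (p ∷ ps)))
layerCount≤W (p ∷ ps) (x ∷ xs) = begin
  p ! * F * ((x C p) * layerCount ps xs + layerCount (p ∷ ps) xs)
    ≡⟨ *-distribˡ-+ (p ! * F) ((x C p) * layerCount ps xs) _ ⟩
  p ! * F * ((x C p) * layerCount ps xs) + p ! * F * layerCount (p ∷ ps) xs
    ≡⟨ cong (_+ p ! * F * layerCount (p ∷ ps) xs) (exchange (p !) F (x C p) _) ⟩
  p ! * (x C p) * (F * layerCount ps xs) + p ! * F * layerCount (p ∷ ps) xs
    ≤⟨ +-mono-≤ (*-mono-≤ (!*C≤^ x p) (layerCount≤W ps xs)) (layerCount≤W (p ∷ ps) xs) ⟩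
  W (p ∷ ps) (x ∷ xs) ∎
  where F = factorials ps

-- Blowing up by `M + s` rather than `M` pays for the falling factorial: a nonzero part has (M + s)
-- y ≥ M y + p.
^≤!*C-scaled : ∀ M {s p} y → p ≤ s → M ^ p * y ^ p ≤ p ! * (((M + s) * y) C p)
^≤!*C-scaled M {s} {zero}  zero    _   = ≤-refl
^≤!*C-scaled M {s} {suc p} zero    _   = ≤-trans (≤-reflexive (*-zeroʳ (M ^ suc p))) z≤n
^≤!*C-scaled M {s} {p}     (suc y) p≤s = begin
  M ^ p * suc y ^ p                 ≡⟨ ^-distribʳ-* M (suc y) p ⟨
  (M * suc y) ^ p                   ≤⟨ ^≤!*C p (≤-trans (+-monoʳ-≤ (M * suc y) (≤-trans p≤s (m≤m*n s (suc y))))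
                                                        (≤-reflexive (sym (*-distribʳ-+ (suc y) M s)))) ⟩
  p ! * (((M + s) * suc y) C p)     ∎

W≤layerCount : ∀ M {s} ps ys → sum ps ≤ s → M ^ sum ps * W ps ys ≤ factorials ps * layerCount ps (map ((M + s) *_) ys)
W≤layerCount M     []       ys       _ = ≤-refl
W≤layerCount M     (p ∷ ps) []       _ = ≤-trans (≤-reflexive (*-zeroʳ (M ^ (p + sum ps)))) z≤n
W≤layerCount M {s} (p ∷ ps) (y ∷ ys) h = begin
  M ^ (p + sum ps) * (y ^ p * W ps ys + W (p ∷ ps) ys)
    ≡⟨ *-distribˡ-+ (M ^ (p + sum ps)) _ _ ⟩
  M ^ (p + sum ps) * (y ^ p * W ps ys) + M ^ (p + sum ps) * W (p ∷ ps) ys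
    ≡⟨ cong (_+ M ^ (p + sum ps) * W (p ∷ ps) ys) (trans (cong (_* (y ^ p * W ps ys)) (^-distribˡ-+-* M p (sum ps))) (exchange (M ^ p) _ _ _)) ⟩
  M ^ p * y ^ p * (M ^ sum ps * W ps ys) + M ^ (p + sum ps) * W (p ∷ ps) ys
    ≤⟨ +-mono-≤ (*-mono-≤ (^≤!*C-scaled M y (m+n≤o⇒m≤o p h)) (W≤layerCount M ps ys (m+n≤o⇒n≤o p h))) (W≤layerCount M (p ∷ ps) ys h) ⟩
  p ! * (((M + s) * y) C p) * (F * layerCount ps zs) + p ! * F * layerCount (p ∷ ps) zs
    ≡⟨ cong (_+ p ! * F * layerCount (p ∷ ps) zs) (exchange (p !) _ F _) ⟩
  p ! * F * ((((M + s) * y) C p) * layerCount ps zs) + p ! * F * layerCount (p ∷ ps) zs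
    ≡⟨ *-distribˡ-+ (p ! * F) _ _ ⟨
  p ! * F * ((((M + s) * y) C p) * layerCount ps zs + layerCount (p ∷ ps) zs) ∎
  where
  F = factorials ps
  zs = map ((M + s) *_) ys

factorials>0 : ∀ ps → 0 < factorials ps
factorials>0 []       = z<s
factorials>0 (p ∷ ps) = *-pos (1≤n! p) (factorials>0 ps)

-- Bernoulli's inequality (M/T)^k ≥ 1 - k s / T for T = M + s, cleared of denominators.
bernoulli-shifted : ∀ M s k → (M + s) * (M + s) ^ k ≤ (M + s) * M ^ k + k * s * (M + s) ^ k
bernoulli-shifted M s zero    = m≤m+n _ _
bernoulli-shifted M s (suc k) = begin
  T * (T * T ^ k)                             ≡⟨ lem M s (T ^ k) ⟩
  M * (T * T ^ k) + s * (T * T ^ k)           ≤⟨ +-monoˡ-≤ _ (*-monoʳ-≤ M (bernoulli-shifted M s k)) ⟩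
  M * (T * M ^ k + k * s * T ^ k) + s * (T * T ^ k) ≤⟨ m≤m+n _ (s * (k * s * T ^ k)) ⟩
  M * (T * M ^ k + k * s * T ^ k) + s * (T * T ^ k) + s * (k * s * T ^ k) ≡⟨ lem₁ M s k (M ^ k) (T ^ k) ⟩
  T * (M * M ^ k) + suc k * s * (T * T ^ k)   ∎
  where
  T = M + s
  lem : ∀ M s x → (M + s) * ((M + s) * x) ≡ M * ((M + s) * x) + s * ((M + s) * x)
  lem = solve-∀
  lem₁ : ∀ M s k y x → M * ((M + s) * y + k * s * x) + s * ((M + s) * x) + s * (k * s * x) ≡ (M + s) * (M * y) + suc k * s * ((M + s) * x)
  lem₁ = solve-∀

shift-^-close : ∀ a s M → 0 < M → suc a * (s * s) ≤ M → a * (M + s) ^ s ≤ suc a * M ^ s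
shift-^-close a s M M>0 h = *-cancelˡ-≤ T {{>-nonZero (≤-trans M>0 (m≤m+n M s))}}
  (+-cancelʳ-≤ (T * T ^ s) _ _ (begin
    T * (a * T ^ s) + T * T ^ s
      ≡⟨ lem T a (T ^ s) ⟩
    suc a * (T * T ^ s)
      ≤⟨ *-monoʳ-≤ (suc a) (bernoulli-shifted M s s) ⟩
    suc a * (T * M ^ s + s * s * T ^ s)
      ≡⟨ lem₁ T a s (M ^ s) (T ^ s) ⟩
    T * (suc a * M ^ s) + suc a * (s * s) * T ^ s
      ≤⟨ +-monoʳ-≤ _ (*-monoˡ-≤ (T ^ s) (≤-trans h (m≤m+n M s))) ⟩
    T * (suc a * M ^ s) + T * T ^ s ∎))
  where
  T = M + s
  lem : ∀ T a x → T * (a * x) + T * x ≡ suc a * (T * x)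
  lem = solve-∀
  lem₁ : ∀ T a s y x → suc a * (T * y + s * s * x) ≡ T * (suc a * y) + suc a * (s * s) * x
  lem₁ = solve-∀

-- From a gap in `W` to a gap in density

module _ (E F : ℕ) (E>0 : 0 < E) (F>0 : 0 < F) where

  -- The gain in W / N^s is 1/E. Two approximations of binomials by powers, each within a factor 1 +
  -- 1/(7E), cost about 2/(7E), and the tolerance 1/(4EF) in density costs at most about F/(4EF) =
  -- 1/(4E); together this is less than 1/E.
  precision closeness : ℕ
  precision = 4 * E * F
  closeness = 7 * E

  private
    e = precision
    a = closeness

  -- o / c and o′ / c′ are the two densities; w / N^s and w′ / (D N)^s the values of W / N^s.
  gap-contradiction : ∀ {o c o′ c′ f w w′ Mˢ Tˢ Dˢ Nˢ} → 0 < f → 0 < Mˢ → 0 < Dˢ → 0 < Nˢ →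
    F * o ≤ w → w ≤ Nˢ → Mˢ * w′ ≤ F * o′ → Dˢ * (E * w + Nˢ) ≤ E * w′ →
    a * Nˢ ≤ suc a * (f * c) → f * c′ ≤ Tˢ * (Dˢ * Nˢ) → a * Tˢ ≤ suc a * Mˢ →
    ¬ o′ * (c * e) ≤ (o * e + c) * c′
  gap-contradiction {o} {c} {o′} {c′} {f} {w} {w′} {Mˢ} {Tˢ} {Dˢ} {Nˢ} f>0 M>0 D>0 N>0 o≤ w≤N o′≥ gap c≥ c′≤ T≤ h =
    <⇒≱ final step₄
    where
    c₁ = f * c
    c₁>0 : 0 < c₁
    c₁>0 = n≢0⇒n>0 λ c₁≡0 → <⇒≱ (*-pos (*-pos {7} z<s E>0) N>0)
             (≤-trans c≥ (≤-reflexive (trans (cong (suc a *_) c₁≡0) (*-zeroʳ (suc a)))))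
    l₁ : ∀ Ms w c f e → Ms * w * (f * c) * e ≡ Ms * w * (f * (c * e))
    l₁ = solve-∀
    l₂ : ∀ F o f c e → F * o * (f * (c * e)) ≡ F * f * (o * (c * e))
    l₂ = solve-∀
    l₃ : ∀ F f o e c x → F * f * ((o * e + c) * x) ≡ (F * o * e + F * c) * (f * x)
    l₃ = solve-∀
    step₁ : Mˢ * w′ * c₁ * e ≤ (w * e + F * c₁) * (Tˢ * (Dˢ * Nˢ))
    step₁ = begin
      Mˢ * w′ * (f * c) * e              ≡⟨ l₁ Mˢ w′ c f e ⟩
      Mˢ * w′ * (f * (c * e))            ≤⟨ *-monoˡ-≤ (f * (c * e)) o′≥ ⟩
      F * o′ * (f * (c * e))             ≡⟨ l₂ F o′ f c e ⟩
      F * f * (o′ * (c * e))             ≤⟨ *-monoʳ-≤ (F * f) h ⟩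
      F * f * ((o * e + c) * c′)         ≡⟨ l₃ F f o e c c′ ⟩
      (F * o * e + F * c) * (f * c′)     ≤⟨ *-mono-≤ (+-mono-≤ (*-monoˡ-≤ e o≤) (*-monoʳ-≤ F (m≤n*m c f {{>-nonZero f>0}}))) c′≤ ⟩
      (w * e + F * c₁) * (Tˢ * (Dˢ * Nˢ)) ∎
    l₄ : ∀ Ms Ds a c e z → Ms * Ds * (a * c * e * z) ≡ a * Ms * c * e * (Ds * z)
    l₄ = solve-∀
    l₅ : ∀ a Ms c e E w → a * Ms * c * e * (E * w) ≡ a * E * (Ms * w * c * e)
    l₅ = solve-∀
    l₆ : ∀ a E z T D N → a * E * (z * (T * (D * N))) ≡ E * z * D * N * (a * T)
    l₆ = solve-∀
    l₇ : ∀ E z D N b Ms → E * z * D * N * (b * Ms) ≡ Ms * D * (b * E * z * N)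
    l₇ = solve-∀
    step₂ : a * c₁ * e * (E * w + Nˢ) ≤ suc a * E * (w * e + F * c₁) * Nˢ
    step₂ = *-cancelˡ-≤ (Mˢ * Dˢ) {{>-nonZero (*-pos M>0 D>0)}} (begin
      Mˢ * Dˢ * (a * c₁ * e * (E * w + Nˢ))           ≡⟨ l₄ Mˢ Dˢ a c₁ e _ ⟩
      a * Mˢ * c₁ * e * (Dˢ * (E * w + Nˢ))           ≤⟨ *-monoʳ-≤ (a * Mˢ * c₁ * e) gap ⟩
      a * Mˢ * c₁ * e * (E * w′)                      ≡⟨ l₅ a Mˢ c₁ e E w′ ⟩
      a * E * (Mˢ * w′ * c₁ * e)                      ≤⟨ *-monoʳ-≤ (a * E) step₁ ⟩
      a * E * ((w * e + F * c₁) * (Tˢ * (Dˢ * Nˢ)))   ≡⟨ l₆ a E (w * e + F * c₁) Tˢ Dˢ Nˢ ⟩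
      E * (w * e + F * c₁) * Dˢ * Nˢ * (a * Tˢ)       ≤⟨ *-monoʳ-≤ (E * (w * e + F * c₁) * Dˢ * Nˢ) T≤ ⟩
      E * (w * e + F * c₁) * Dˢ * Nˢ * (suc a * Mˢ)   ≡⟨ l₇ E (w * e + F * c₁) Dˢ Nˢ (suc a) Mˢ ⟩
      Mˢ * Dˢ * (suc a * E * (w * e + F * c₁) * Nˢ)   ∎)
    l₈ : ∀ c a e z → c * (a * a * e * z) ≡ a * (a * c * e * z)
    l₈ = solve-∀
    l₉ : ∀ a b E w e F c N → a * (b * E * (w * e + F * c) * N) ≡ b * E * w * e * (a * N) + a * b * E * F * N * c
    l₉ = solve-∀
    l₁₀ : ∀ a b E w e F c N → b * E * w * e * (b * c) + a * b * E * F * N * c ≡ c * (b * b * E * w * e + a * b * E * F * N)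
    l₁₀ = solve-∀
    step₃ : a * a * e * (E * w + Nˢ) ≤ suc a * suc a * E * w * e + a * suc a * E * F * Nˢ
    step₃ = *-cancelˡ-≤ c₁ {{>-nonZero c₁>0}} (begin
      c₁ * (a * a * e * (E * w + Nˢ))                         ≡⟨ l₈ c₁ a e _ ⟩
      a * (a * c₁ * e * (E * w + Nˢ))                         ≤⟨ *-monoʳ-≤ a step₂ ⟩
      a * (suc a * E * (w * e + F * c₁) * Nˢ)                 ≡⟨ l₉ a (suc a) E w e F c₁ Nˢ ⟩
      suc a * E * w * e * (a * Nˢ) + a * suc a * E * F * Nˢ * c₁ ≤⟨ +-monoˡ-≤ _ (*-monoʳ-≤ (suc a * E * w * e) c≥) ⟩
      suc a * E * w * e * (suc a * c₁) + a * suc a * E * F * Nˢ * c₁ ≡⟨ l₁₀ a (suc a) E w e F c₁ Nˢ ⟩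
      c₁ * (suc a * suc a * E * w * e + a * suc a * E * F * Nˢ) ∎)
    l₁₁ : ∀ a e E w N → N * (a * a * e) + a * a * e * E * w ≡ a * a * e * (E * w + N)
    l₁₁ = solve-∀
    l₁₂ : ∀ a e E w F N → suc a * suc a * E * w * e + a * suc a * E * F * N ≡ (2 * a + 1) * E * e * w + a * suc a * E * F * N + a * a * e * E * w
    l₁₂ = solve-∀
    l₁₃ : ∀ x y N → x * N + y * N ≡ N * (x + y)
    l₁₃ = solve-∀
    -- The approximation errors are relative to `w`, the gain is not; `w ≤ Nˢ` brings both to the
    -- same scale.
    step₄ : a * a * e ≤ (2 * a + 1) * E * e + a * suc a * E * F
    step₄ = *-cancelˡ-≤ Nˢ {{>-nonZero N>0}} (+-cancelʳ-≤ (a * a * e * E * w) _ _ (begin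
      Nˢ * (a * a * e) + a * a * e * E * w                                 ≡⟨ l₁₁ a e E w Nˢ ⟩
      a * a * e * (E * w + Nˢ)                                             ≤⟨ step₃ ⟩
      suc a * suc a * E * w * e + a * suc a * E * F * Nˢ                   ≡⟨ l₁₂ a e E w F Nˢ ⟩
      (2 * a + 1) * E * e * w + a * suc a * E * F * Nˢ + a * a * e * E * w
        ≤⟨ +-monoˡ-≤ _ (+-monoˡ-≤ _ (*-monoʳ-≤ ((2 * a + 1) * E * e) w≤N)) ⟩
      (2 * a + 1) * E * e * Nˢ + a * suc a * E * F * Nˢ + a * a * e * E * w ≡⟨ cong (_+ a * a * e * E * w) (l₁₃ ((2 * a + 1) * E * e) _ Nˢ) ⟩
      Nˢ * ((2 * a + 1) * E * e + a * suc a * E * F) + a * a * e * E * w ∎))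
    l₁₄ : ∀ E F → (2 * (7 * E) + 1) * E * (4 * E * F) + 7 * E * suc (7 * E) * E * F ≡ 105 * (E * E * E * F) + 11 * (1 * E * E * F)
    l₁₄ = solve-∀
    l₁₅ : ∀ z → 105 * z + 11 * z + 80 * z ≡ 196 * z
    l₁₅ = solve-∀
    l₁₆ : ∀ E F → 196 * (E * E * E * F) ≡ 7 * E * (7 * E) * (4 * E * F)
    l₁₆ = solve-∀
    E³F>0 : 0 < 80 * (E * E * E * F)
    E³F>0 = *-pos {80} z<s (*-pos (*-pos (*-pos E>0 E>0) E>0) F>0)
    final : (2 * a + 1) * E * e + a * suc a * E * F < a * a * e
    final = begin-strict
      (2 * a + 1) * E * e + a * suc a * E * F               ≡⟨ l₁₄ E F ⟩
      105 * (E * E * E * F) + 11 * (1 * E * E * F)          ≤⟨ +-monoʳ-≤ (105 * (E * E * E * F)) (*-monoʳ-≤ 11 (*-monoˡ-≤ F (*-monoˡ-≤ E (*-monoˡ-≤ E E>0)))) ⟩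
      105 * (E * E * E * F) + 11 * (E * E * E * F)          <⟨ m<m+n _ E³F>0 ⟩
      105 * (E * E * E * F) + 11 * (E * E * E * F) + 80 * (E * E * E * F) ≡⟨ l₁₅ (E * E * E * F) ⟩
      196 * (E * E * E * F)                                 ≡⟨ l₁₆ E F ⟩
      a * a * e                                             ∎

-- The maximum itself is not computable from f; its double negation suffices to refute.
¬¬-maximum : {A : Set} (f : A → ℕ) → A → ∀ b → (∀ a → f a ≤ b) → ¬ ¬ ∃ λ a → ∀ a′ → f a′ ≤ f a
¬¬-maximum f a₀ b f≤b none = attains (suc b) λ (a , b<fa) → <⇒≱ b<fa (f≤b a)
  where
  attains : ∀ j → ¬ ¬ ∃ λ a → j ≤ f a
  attains zero    k = k (a₀ , z≤n)
  attains (suc j) k = attains j λ (a , j≤fa) →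
    none (a , λ a′ → ≤-trans (≮⇒≥ λ j<fa′ → k (a′ , j<fa′)) j≤fa)

¬¬-maxDensity : ∀ {s n} (σ : Permutation′ s) → Permutation′ n → ¬ ¬ ∃ λ q → IsMaxDensity σ n q
¬¬-maxDensity {s} {n} σ π₀ none =
  ¬¬-maximum (λ π → occurrences σ π) π₀ (length (choose s (allFin n)))
    (λ π → length-filter (T? ∘ induces σ π) (choose s (allFin n)))
    λ (π , max) → none (density σ π , (π , refl) , λ π′ → frac-mono (n C s) (max π′))

module _ {ps : List ℕ} (pos : All (1 ≤_) ps) (E : ℕ) (E>0 : 0 < E) where

  private
    s = sum ps
    F = factorials ps
    a = closeness E F E>0 (factorials>0 ps)
    e = precision E F E>0 (factorials>0 ps)

  sizeBound : ℕ
  sizeBound = suc (suc a * (s * s))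

  tolerance : ℚ
  tolerance = frac 1 (precision E F E>0 (factorials>0 ps))

  private
    e>0 : 0 < e
    e>0 = *-pos (*-pos {4} z<s E>0) (factorials>0 ps)

  tolerance>0 : 0ℚ ℚ.< tolerance
  tolerance>0 with suc d ← e | _ ← e>0 = frac>0 d

  -- A blow-up of the better configuration is denser by more than the tolerance.
  beaten-contradiction : ∀ xs → sizeBound + s ≤ sum xs → Beaten ps E (sum xs ^ s) xs →
    (σ : Permutation′ s) (π : Permutation′ (sum xs)) → FollowsLayers σ ps → FollowsLayers π xs → ∀ N →
    ¬ (∀ n → N ≤ n → ∀ q → IsMaxDensity σ n q → ℚ.∣ density σ π ℚ.- q ∣ ℚ.≤ tolerance)
  beaten-contradiction xs size (ys , D , D>0 , sum-ys , gap) σ π σ-layers π-layers N near =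
    ¬¬-maxDensity σ π′ λ (q , isMax) →
      gap-contradiction E F E>0 (factorials>0 ps) {o = o} {c} {o′} {c′} {s !} {W ps xs} {W ps ys} {M ^ s} {(M + s) ^ s} {D ^ s} {X ^ s}
        (1≤n! s) (^-pos s z<s) (^-pos s D>0) (^-pos s X>0)
        o≤ (W-bound pos xs) o′≥ gap c≥ c′≤
        (shift-^-close a s M z<s (≤-trans (m≤m+n _ N) (n≤1+n _)))
        (frac-≤-+ c′>0 c>0 e>0 (ℚ.≤-trans (proj₂ isMax π′)
          (∣p-q∣≤ε⇒q≤p+ε (density σ π) q tolerance (near (sum zs) N≤ q isMax))))
    where
    X = sum xs
    X>0 : 0 < X
    X>0 = ≤-trans z<s size
    -- Large enough for `shift-^-close`, and for the order of `π′` to reach `N`, where `near`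
    -- applies. The comparison is with the maximum at the order of `π′`, which may differ from that
    -- of `π`.
    M = suc (suc a * (s * s) + N)
    zs = map ((M + s) *_) ys
    π′ = layeredPermutation zs
    o  = occurrences σ π
    c  = X C s
    o′ = occurrences σ π′
    c′ = sum zs C s
    sum-zs : sum zs ≡ (M + s) * (D * X)
    sum-zs = trans (sum-scale (M + s) ys) (cong ((M + s) *_) sum-ys)
    M+s≤ : M + s ≤ sum zs
    M+s≤ = ≤-trans (m≤m*n (M + s) (D * X) {{>-nonZero (*-pos D>0 X>0)}}) (≤-reflexive (sym sum-zs))
    N≤ : N ≤ sum zs
    N≤ = ≤-trans (≤-trans (m≤n+m N (suc (suc a * (s * s)))) (m≤m+n M s)) M+s≤
    C>0 : ∀ {n} → 1 + s ≤ n → 0 < n C s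
    C>0 {n} h = n≢0⇒n>0 λ C≡0 → <⇒≱ (^-pos {1} s z<s)
      (≤-trans (^≤!*C s h) (≤-reflexive (trans (cong (s ! *_) C≡0) (*-zeroʳ (s !)))))
    c′>0 : 0 < c′
    c′>0 = C>0 (≤-trans (s≤s (m≤n+m s _)) M+s≤)
    c>0 : 0 < c
    c>0 = C>0 (≤-trans (s≤s (m≤n+m s _)) size)
    o≤ : F * o ≤ W ps xs
    o≤ = ≤-trans (≤-reflexive (cong (F *_) (occurrences-layered xs pos σ π σ-layers π-layers))) (layerCount≤W ps xs)
    o′≥ : M ^ s * W ps ys ≤ F * o′
    o′≥ = ≤-trans (W≤layerCount M ps ys ≤-refl) (≤-reflexive (cong (F *_)
      (sym (occurrences-layered zs pos σ π′ σ-layers (layeredPermutation-layers zs)))))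
    c≥ : a * X ^ s ≤ suc a * (s ! * c)
    c≥ = subst (λ z → a * z ^ s ≤ suc a * (s ! * c)) (m∸n+n≡m (≤-trans (m≤n+m s sizeBound) size))
      (≤-trans (shift-^-close a s (X ∸ s) (≤-trans z<s M₀≤) (≤-trans (n≤1+n _) M₀≤))
               (*-monoʳ-≤ (suc a) (^≤!*C s (≤-reflexive (m∸n+n≡m (≤-trans (m≤n+m s sizeBound) size))))))
      where
      M₀≤ : sizeBound ≤ X ∸ s
      M₀≤ = m+n≤o⇒m≤o∸n sizeBound size
    c′≤ : s ! * c′ ≤ (M + s) ^ s * (D ^ s * X ^ s)
    c′≤ = ≤-trans (!*C≤^ (sum zs) s) (≤-reflexive (trans (cong (_^ s) sum-zs)
      (trans (^-distribʳ-* (M + s) (D * X) s) (cong ((M + s) ^ s *_) (^-distribʳ-* D X s)))))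

unboundedly-many-layers : ∀ {ps} → All (1 ≤_) ps → (∃ λ E₀ → 0 < E₀ × Improvable ps E₀) →
  ∀ {s} (σ : Permutation′ s) → HasLayers σ ps →
  ∀ (size : ℕ → ℕ) (π : ∀ m → Permutation′ (size m)) → NearOptimal σ size π →
  ∀ L → ∃ λ M → ∀ m → M ≤ m → ∀ ls → HasLayers (π m) ls → L ≤ length ls
unboundedly-many-layers {ps} pos (E₀ , E₀>0 , improvable) σ (_ , refl , σ-layers) size π (size→∞ , near) L =
  -- The refutation holds under a double negation, and decidability of the goal recovers the
  -- positive statement. `M₂` bounds both `m` and the orders compared.
  M₁ ⊔ M₂ , λ m M≤m ls layers → decidable-stable (L ≤? length ls) λ L≰ →
    few-layers (π m) ls layers (<⇒≤ (≰⇒> L≰)) (proj₂ (size→∞ _) m (≤-trans (m≤m⊔n M₁ M₂) M≤m)) M₂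
      (λ n M₂≤n → proj₂ (near _ (tolerance>0 pos E E>0)) m n (≤-trans (m≤n⊔m M₁ M₂) M≤m) M₂≤n)
  where
  E = gapConst pos E₀ E₀>0 improvable L
  E>0 = gapConst>0 pos E₀ E₀>0 improvable L
  M₁ = proj₁ (size→∞ (sizeBound pos E E>0 + sum ps))
  M₂ = proj₁ (near (tolerance pos E E>0) (tolerance>0 pos E E>0))
  few-layers : ∀ {n} (π : Permutation′ n) ls → HasLayers π ls → length ls ≤ L → sizeBound pos E E>0 + sum ps ≤ n →
    ∀ N → ¬ (∀ n → N ≤ n → ∀ q → IsMaxDensity σ n q → ℚ.∣ density σ π ℚ.- q ∣ ℚ.≤ tolerance pos E E>0)
  few-layers π ls (_ , refl , π-layers) len large =
    beaten-contradiction pos E E>0 ls large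
      (Gap-gapConst pos E₀ E₀>0 improvable L ls len (≤-trans z<s large)) σ π σ-layers π-layers

theorem1p4 : ∀ (ls : List ℕ) → All (1 ≤_) ls →
    ∃ λ n₀ → ∀ (n : ℕ) → n₀ ≤ n →
    ∀ {s : ℕ} (σ : Permutation′ s) → HasLayers σ (n ∷ 1 ∷ ls) →
    ∀ (size : ℕ → ℕ) (π : (m : ℕ) → Permutation′ (size m)) →
    (∀ m → IsLayered (π m)) → NearOptimal σ size π →
    ∀ (L : ℕ) → ∃ λ M → ∀ m → M ≤ m →
    ∀ (lsₘ : List ℕ) → HasLayers (π m) lsₘ → L ≤ length lsₘ
theorem1p4 [] [] = 1 , λ { (suc n) _ σ σ-layers size π _ near →
  unboundedly-many-layers (s≤s z≤n ∷ s≤s z≤n ∷ []) (improvable-n-1 n) σ σ-layers size π near }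
-- `threshold` has the same value for every first layer, so its instance at `0` fixes `n₀`; the
-- outer `suc` accounts for the first layer being `suc n`.
theorem1p4 (suc l ∷ ls) (_ ∷ pos) = suc (threshold 0 l ls pos) , λ { (suc n) (s≤s large) σ σ-layers size π _ near →
  unboundedly-many-layers (s≤s z≤n ∷ s≤s z≤n ∷ s≤s z≤n ∷ pos) (improvable-n-1-ℓ n l ls pos large) σ σ-layers size π near }
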